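{- For the Proportional Online Unbounded Knapsack Problem with Removal, the randomized online algorithm RandChoice achieves a (strict) competitive ratio in expectation of at most $4/3$.
   Context: Problem. An instance of the Online Unbounded Knapsack Problem with Removal is a finite sequence of items $I=(x_1,\dots,x_n)$, where an item $x=(w,v)$ has a weight $w(x)=w\in(0,1]$ and a value $v(x)=v\in\mathbb{R}_{>0}$. A solution is a finite multiset $S$ of items from $I$ (each item may appear arbitrarily often) with total weight at most $1$; its gain is the sum of the values of its elements, denoted $v(\cdot)$. $\mathrm{Opt}(I)$ denotes a solution to $I$ of maximum gain. In the proportional variant, every item satisfies $w(x)=v(x)$, and an item $x$ is identified with this number, $x=w(x)=v(x)\in(0,1]$. Online algorithms. An online algorithm maintains a solution ("knapsack") $K$, initially empty. Items arrive one by one in order; when an item $x$ arrives, the algorithm, knowing only the items received so far, may add any number of copies of $x$ to $K$ and then remove an arbitrary sub-multiset, such that $K$ is again a valid solution. $\mathrm{Alg}(I)$ denotes the solution held after all of $I$ has been processed. A randomized algorithm may use random choices; the instance is fixed independently of these. Competitive ratio. A randomized algorithm Alg is (strictly) $c$-competitive in expectation, for a constant $c\ge 1$, if $c\cdot \mathbb{E}[v(\mathrm{Alg}(I))]\ge v(\mathrm{Opt}(I))$ for every instance $I$. Its (strict) competitive ratio in expectation is the infimum of all such $c\ge1$. Notation. $\mathrm{fill}(x)$ is the multiset consisting of $\lfloor 1/x\rfloor$ copies of $x$. Item categories: $G=[0,1/3]\cup[3/8,1/2]\cup[3/4,1]$, $S=(1/3,3/8)$, $M=(1/2,5/8)$,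 $L=[5/8,3/4)$. Algorithm RandChoice. At the beginning, choose one of the two deterministic strategies $A_1,A_2$, each with probability $1/2$, and follow it on the whole instance. Both start with $K=\emptyset$ and output the final $K$. Strategy $A_1$. For each arriving item $x$: (a) if $x\in G$, set $K=\mathrm{fill}(x)$ and ignore all further items; (b) otherwise, if $K=\emptyset$, set $K=\mathrm{fill}(x)$; (c) otherwise, if $K=\mathrm{fill}(x')$ for some $x'\in S\cup M\cup L$, apply the first applicable rule: (1) if $\min(x,x')\in S$, $\max(x,x')\in M\cup L$ and $x+x'\le1$, set $K=\{x,x'\}$; (2) if $x\in S$ and $x<x'$, set $K=\{x,x\}$; (3) if $x\in M$, $x'\in M$ and $x>x'$, set $K=\{x\}$; (4) if $x'\in L$ and $x<x'$, set $K=\{x\}$; if none applies, leave $K$ unchanged; (d) otherwise, $K=\{s,b\}$ with $s\in S$ and $b\in M\cup L$: if $x<s$, set $K=\{x,b\}$; else if $x>b$ and $x+s\le1$, set $K=\{s,x\}$; else leave $K$ unchanged. Strategy $A_2$. For each arriving item $x$: (a) if $x\in G$, set $K=\mathrm{fill}(x)$ and ignore all further items; (b) otherwise, if $K=\emptyset$, set $K=\mathrm{fill}(x)$; (c) otherwise, if $K=\mathrm{fill}(x')$ for some $x'\in S\cup M\cup L$, apply the first applicable rule: (1) if $\min(x,x')\in S$, $\max(x,x')\in L$ and $x+x'\le1$, set $K=\{x,x'\}$; (2) if $x\in L$ and $x'\in S\cup M$, set $K=\{x\}$; (3) if $x\in L$ and $x<x'$, set $K=\{x\}$; (4) if $x\in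 S$, $x'\in S\cup M$ and $x<x'$, set $K=\{x,x\}$; (5) if $x\in M$, $x'\in M$ and $x>x'$, set $K=\{x\}$; if none applies, leave $K$ unchanged; (d) otherwise ($K$ consists of one item of $S$ and one item of $L$), leave $K$ unchanged. -}

module Defs where

open import Algebra.Bundles using (CommutativeRing)
import Algebra.Properties.Ring as RingProperties
import Algebra.Properties.Semiring.Mult as SemiringMult
open import Data.Bool.Base using (if_then_else_)
open import Data.Empty using (⊥-elim)
open import Data.List.Base using (List; []; _∷_; [_]; _++_; _∷ʳ_; map; foldr; foldl; replicate)
open import Data.List.Properties using (foldl-∷ʳ; ++-identityʳ)
open import Data.List.Membership.Propositional using (_∈_)
open import Data.List.Relation.Unary.All using (All; []; _∷_)
open import Data.List.Relation.Binary.Permutation.Propositional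
  using (_↭_; ↭-refl; ↭-trans; ↭-reflexive; prep; swap)
open import Data.Nat.Base using (ℕ; zero; suc; NonZero)
open import Data.Product.Base using (∃; ∃-syntax; _×_; _,_; proj₁; proj₂)
open import Data.Sum.Base using (_⊎_; inj₁; inj₂)
open import Level using (_⊔_) renaming (suc to lsuc)
open import Relation.Binary.Core using (Rel)
open import Relation.Binary.Bundles using (DecTotalOrder)
open import Relation.Binary.Structures using (IsDecTotalOrder)
import Relation.Binary.Construct.NonStrictToStrict as Strict
open import Relation.Binary.PropositionalEquality using (_≡_; refl; sym; cong; subst)
open import Relation.Nullary using (¬_; Dec; yes; no; does)
open import Relation.Nullary.Decidable using (_×-dec_; _⊎-dec_)
open import Relation.Unary using (Pred; Decidable)

-- The properties of ℝ that the problem and the algorithm use: field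
-- operations, case distinctions on the order, and the existence of ⌊1/x⌋.
-- The classical real numbers are an instance, and so are the rationals.
record ArchimedeanOrderedField c ℓ₁ ℓ₂ : Set (lsuc (c ⊔ ℓ₁ ⊔ ℓ₂)) where
  infix  8 _⁻¹
  infix  4 _≤_ _<?_
  field
    commutativeRing : CommutativeRing c ℓ₁

  open CommutativeRing commutativeRing public
    hiding (reflexive; zero)
    renaming (refl to ≈-refl; sym to ≈-sym; trans to ≈-trans)
  open SemiringMult semiring using () renaming (_×_ to _·_)

  fromℕ : ℕ → Carrier
  fromℕ n = n · 1#

  field
    _≤_             : Rel Carrier ℓ₂
    isDecTotalOrder : IsDecTotalOrder _≈_ _≤_
    +-monoˡ-≤       : ∀ {x y} z → x ≤ y → x + z ≤ y + z
    *-nonNegative   : ∀ {x y} → 0# ≤ x → 0# ≤ y → 0# ≤ x * y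
    0≉1             : ¬ 0# ≈ 1#
    -- Total, with an unspecified value at 0#.
    _⁻¹             : Carrier → Carrier
    ⁻¹-cong         : ∀ {x y} → x ≈ y → x ⁻¹ ≈ y ⁻¹
    *-inverseʳ      : ∀ {x} → ¬ x ≈ 0# → x * x ⁻¹ ≈ 1#
    archimedean     : ∀ x → ∃[ n ] x ≤ fromℕ n

  decTotalOrder : DecTotalOrder c ℓ₁ ℓ₂
  decTotalOrder = record { isDecTotalOrder = isDecTotalOrder }

  open IsDecTotalOrder isDecTotalOrder public
    using (_≟_; _≤?_; total; antisym; ≤-respˡ-≈; ≤-respʳ-≈)
    renaming (refl to ≤-refl; trans to ≤-trans; reflexive to ≤-reflexive)

  open Strict _≈_ _≤_ public using (_<_)

  _<?_ : ∀ x y → Dec (x < y)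
  _<?_ = Strict.<-decidable _≈_ _≤_ _≟_ _≤?_

  infixl 7 _/_
  _/_ : (m n : ℕ) .{{_ : NonZero n}} → Carrier
  m / n = fromℕ m * fromℕ n ⁻¹

  -- The largest k ≤ n with fromℕ k ≤ x, or 0 if there is none.
  floorUpTo : ℕ → Carrier → ℕ
  floorUpTo zero    x = zero
  floorUpTo (suc n) x = if does (fromℕ (suc n) ≤? x) then suc n else floorUpTo n x

  -- The integer part of x if x is nonnegative.
  ⌊_⌋ : Carrier → ℕ
  ⌊ x ⌋ = floorUpTo (proj₁ (archimedean x)) x

module OrderedFieldProperties {c ℓ₁ ℓ₂} (R : ArchimedeanOrderedField c ℓ₁ ℓ₂) where
  open ArchimedeanOrderedField R
  open RingProperties ring using (-‿distribʳ-*; -‿distribˡ-*; -‿involutive)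

  +-monoʳ-≤ : ∀ {x y} z → x ≤ y → z + x ≤ z + y
  +-monoʳ-≤ z p = ≤-respˡ-≈ (+-comm _ z) (≤-respʳ-≈ (+-comm _ z) (+-monoˡ-≤ z p))

  0≤y-x : ∀ {x y} → x ≤ y → 0# ≤ y + - x
  0≤y-x {x} p = ≤-respˡ-≈ (-‿inverseʳ x) (+-monoˡ-≤ (- x) p)

  0≤y-x⇒x≤y : ∀ {x y} → 0# ≤ y + - x → x ≤ y
  0≤y-x⇒x≤y {x} {y} p = ≤-respˡ-≈ (+-identityˡ x) (≤-respʳ-≈ eq (+-monoˡ-≤ x p))
    where
    eq : (y + - x) + x ≈ y
    eq = ≈-trans (+-assoc y (- x) x)
           (≈-trans (+-congˡ (-‿inverseˡ x)) (+-identityʳ y))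

  *-monoˡ-≤ : ∀ {x y z} → 0# ≤ z → x ≤ y → x * z ≤ y * z
  *-monoˡ-≤ {x} {y} {z} 0≤z p = 0≤y-x⇒x≤y
    (≤-respʳ-≈ (≈-trans (distribʳ z y (- x)) (+-congˡ (≈-sym (-‿distribˡ-* x z))))
      (*-nonNegative (0≤y-x p) 0≤z))

  x≤0⇒0≤-x : ∀ {x} → x ≤ 0# → 0# ≤ - x
  x≤0⇒0≤-x p = ≤-respʳ-≈ (+-identityˡ _) (0≤y-x p)

  0≤1 : 0# ≤ 1#
  0≤1 with total 0# 1#
  ... | inj₁ p = p
  ... | inj₂ p = ≤-respʳ-≈ eq (*-nonNegative q q)
    where
    q : 0# ≤ - 1#
    q = x≤0⇒0≤-x p
    eq : (- 1#) * (- 1#) ≈ 1#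
    eq = ≈-trans (≈-sym (-‿distribˡ-* 1# (- 1#)))
           (≈-trans (-‿cong (*-identityˡ (- 1#))) (-‿involutive 1#))

  1≰0 : ¬ 1# ≤ 0#
  1≰0 p = 0≉1 (antisym 0≤1 p)

  0≤x⁻¹ : ∀ {x} → 0# ≤ x → ¬ x ≈ 0# → 0# ≤ x ⁻¹
  0≤x⁻¹ {x} 0≤x x≉0 with total 0# (x ⁻¹)
  ... | inj₁ p = p
  ... | inj₂ p = ⊥-elim (1≰0 (0≤y-x⇒x≤y (≤-respʳ-≈ eq (*-nonNegative 0≤x (x≤0⇒0≤-x p)))))
    where
    eq : x * (- (x ⁻¹)) ≈ 0# + - 1#
    eq = ≈-trans (≈-sym (-‿distribʳ-* x (x ⁻¹)))
           (≈-trans (-‿cong (*-inverseʳ x≉0)) (≈-sym (+-identityˡ (- 1#))))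

  0≤fromℕ : ∀ n → 0# ≤ fromℕ n
  0≤fromℕ zero    = ≤-refl
  0≤fromℕ (suc n) = ≤-trans 0≤1
    (≤-respˡ-≈ (+-identityʳ 1#) (+-monoʳ-≤ 1# (0≤fromℕ n)))

  fromℕ≉0 : ∀ n → ¬ fromℕ (suc n) ≈ 0#
  fromℕ≉0 n eq = 1≰0 (≤-respʳ-≈ eq
    (≤-respˡ-≈ (+-identityʳ 1#) (+-monoʳ-≤ 1# (0≤fromℕ n))))

  0≤1/2 : 0# ≤ 1 / 2
  0≤1/2 = *-nonNegative (0≤fromℕ 1) (0≤x⁻¹ (0≤fromℕ 2) (fromℕ≉0 1))

  1/2+1/2≈1 : 1 / 2 + (1 / 2 + 0#) ≈ 1#
  1/2+1/2≈1 = ≈-trans (+-congˡ (+-identityʳ _))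
    (≈-trans (≈-sym (distribʳ _ _ _))
      (≈-trans (*-congʳ (+-congʳ (+-identityʳ 1#))) (*-inverseʳ (fromℕ≉0 1))))

  floorUpTo≤ : ∀ n {x} → 0# ≤ x → fromℕ (floorUpTo n x) ≤ x
  floorUpTo≤ zero    0≤x = 0≤x
  floorUpTo≤ (suc n) {x} 0≤x with fromℕ (suc n) ≤? x
  ... | yes p = p
  ... | no  _ = floorUpTo≤ n 0≤x

  floorUpTo-positive : ∀ n {x} → 1# ≤ x → x ≤ fromℕ n → ∃[ k ] floorUpTo n x ≡ suc k
  floorUpTo-positive n {x} 1≤x x≤n = go n (≤-trans 1≤x x≤n)
    where
    go : ∀ n → 1# ≤ fromℕ n → ∃[ k ] floorUpTo n x ≡ suc k
    go zero    p = ⊥-elim (1≰0 p)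
    go (suc n) p with fromℕ (suc n) ≤? x
    ... | yes _ = n , refl
    go (suc zero)    p | no q = ⊥-elim (q (≤-respˡ-≈ (≈-sym (+-identityʳ 1#)) 1≤x))
    go (suc (suc n)) p | no q = go (suc n)
      (≤-respˡ-≈ (+-identityʳ 1#) (+-monoʳ-≤ 1# (0≤fromℕ n)))

module Knapsack {c ℓ₁ ℓ₂} (R : ArchimedeanOrderedField c ℓ₁ ℓ₂) where
  open ArchimedeanOrderedField R
  open OrderedFieldProperties R

  -- In the proportional variant, weight and value are the same number.
  record Item : Set (c ⊔ ℓ₁ ⊔ ℓ₂) where
    field
      size   : Carrier
      0<size : 0# < size
      size≤1 : size ≤ 1#
  open Item public

  Instance : Set (c ⊔ ℓ₁ ⊔ ℓ₂)
  Instance = List Item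

  -- Lists, compared up to permutation where the order could matter.
  Multiset : Set (c ⊔ ℓ₁ ⊔ ℓ₂)
  Multiset = List Item

  sum : List Carrier → Carrier
  sum = foldr _+_ 0#

  weight : Multiset → Carrier
  weight S = sum (map size S)

  gain : Multiset → Carrier
  gain = weight

  IsSolution : Instance → Multiset → Set (c ⊔ ℓ₁ ⊔ ℓ₂)
  IsSolution I S = All (_∈ I) S × weight S ≤ 1#

  IsOptimal : Instance → Multiset → Set (c ⊔ ℓ₁ ⊔ ℓ₂)
  IsOptimal I S = IsSolution I S × (∀ T → IsSolution I T → gain T ≤ gain S)

  -- K′ arises from K by adding k copies of x and then removing some multiset D.
  Update : Multiset → Item → Multiset → Set (c ⊔ ℓ₁ ⊔ ℓ₂)
  Update K x K′ = ∃[ k ] ∃[ D ] K′ ++ D ↭ replicate k x ++ K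

  -- A deterministic online algorithm, given by the knapsack it holds after
  -- each finite sequence of arrivals.  By initial and update it only ever
  -- holds items that have arrived.
  record OnlineAlgorithm : Set (c ⊔ ℓ₁ ⊔ ℓ₂) where
    field
      knapsack : Instance → Multiset
      initial  : knapsack [] ≡ []
      update   : ∀ I x → Update (knapsack I) x (knapsack (I ∷ʳ x))
      feasible : ∀ I → weight (knapsack I) ≤ 1#
  open OnlineAlgorithm public

  -- A finitely supported probability distribution on deterministic algorithms.
  record RandomizedOnlineAlgorithm : Set (c ⊔ ℓ₁ ⊔ ℓ₂) where
    field
      choices     : List (Carrier × OnlineAlgorithm)
      nonNegative : All (λ pA → 0# ≤ proj₁ pA) choices
      sum≈1       : sum (map proj₁ choices) ≈ 1#

    expectedGain : Instance → Carrier
    expectedGain I = sum (map (λ (p , A) → p * gain (knapsack A I)) choices)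
  open RandomizedOnlineAlgorithm public

  IsCompetitive : RandomizedOnlineAlgorithm → Carrier → Set (c ⊔ ℓ₁ ⊔ ℓ₂)
  IsCompetitive Alg r =
    1# ≤ r × (∀ I Opt → IsOptimal I Opt → gain Opt ≤ r * expectedGain Alg I)

  IsInfimum : ∀ {p} → Pred Carrier p → Carrier → Set (c ⊔ ℓ₂ ⊔ p)
  IsInfimum P i = (∀ r → P r → i ≤ r) × (∀ l → (∀ r → P r → l ≤ r) → l ≤ i)

  IsCompetitiveRatio : RandomizedOnlineAlgorithm → Carrier → Set (c ⊔ ℓ₁ ⊔ ℓ₂)
  IsCompetitiveRatio Alg = IsInfimum (IsCompetitive Alg)

  G : Pred Item ℓ₂
  G x = (0# ≤ size x × size x ≤ 1 / 3)
      ⊎ (3 / 8 ≤ size x × size x ≤ 1 / 2)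
      ⊎ (3 / 4 ≤ size x × size x ≤ 1#)

  S M L : Pred Item (ℓ₁ ⊔ ℓ₂)
  S x = 1 / 3 < size x × size x < 3 / 8
  M x = 1 / 2 < size x × size x < 5 / 8
  L x = 5 / 8 ≤ size x × size x < 3 / 4

  G? : Decidable G
  G? x = (0# ≤? size x ×-dec size x ≤? 1 / 3)
     ⊎-dec (3 / 8 ≤? size x ×-dec size x ≤? 1 / 2)
     ⊎-dec (3 / 4 ≤? size x ×-dec size x ≤? 1#)

  S? : Decidable S
  S? x = 1 / 3 <? size x ×-dec size x <? 3 / 8

  M? : Decidable M
  M? x = 1 / 2 <? size x ×-dec size x <? 5 / 8

  L? : Decidable L
  L? x = 5 / 8 ≤? size x ×-dec size x <? 3 / 4

  infix 4 _≺?_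
  _≺?_ : ∀ x y → Dec (size x < size y)
  x ≺? y = size x <? size y

  min max : Item → Item → Item
  min x y = if does (size x ≤? size y) then x else y
  max x y = if does (size x ≤? size y) then y else x

  fill : Item → Multiset
  fill x = replicate ⌊ size x ⁻¹ ⌋ x

  -- filled x stands for fill(x); for x ∈ S this is {x,x}, and for x ∈ M ∪ L
  -- it is {x}, so that it also covers the results {x,x} and {x} of the rules.
  data Knap : Set (c ⊔ ℓ₁ ⊔ ℓ₂) where
    empty  : Knap
    filled : Item → Knap
    pair   : (s b : Item) → Knap

  data State : Set (c ⊔ ℓ₁ ⊔ ℓ₂) where
    running : Knap → State
    -- K = fill(x), and all further items are ignored.
    stopped : Item → State

  ⟦_⟧ : Knap → Multiset
  ⟦ empty ⟧    = []
  ⟦ filled x ⟧ = fill x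
  ⟦ pair s b ⟧ = s ∷ b ∷ []

  contents : State → Multiset
  contents (running K) = ⟦ K ⟧
  contents (stopped x) = fill x

  -- The treatment of items outside G.
  Rules : Set (c ⊔ ℓ₁ ⊔ ℓ₂)
  Rules = Knap → Item → Knap

  step : Rules → State → Item → State
  step rules (stopped y) x = stopped y
  step rules (running K) x = if does (G? x) then stopped x else running (rules K x)

  rules₁ : Rules
  rules₁ empty x = filled x
  rules₁ (filled x′) x =
    if does (S? (min x x′) ×-dec (M? (max x x′) ⊎-dec L? (max x x′)) ×-dec size x + size x′ ≤? 1#)
      then pair (min x x′) (max x x′)
    else if does (S? x ×-dec x ≺? x′) then filled x
    else if does (M? x ×-dec M? x′ ×-dec x′ ≺? x) then filled x
    else if does (L? x′ ×-dec x ≺? x′) then filled x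
    else filled x′
  rules₁ (pair s b) x =
    if does (x ≺? s) then pair x b
    else if does (b ≺? x ×-dec size x + size s ≤? 1#) then pair s x
    else pair s b

  rules₂ : Rules
  rules₂ empty x = filled x
  rules₂ (filled x′) x =
    if does (S? (min x x′) ×-dec L? (max x x′) ×-dec size x + size x′ ≤? 1#)
      then pair (min x x′) (max x x′)
    else if does (L? x ×-dec (S? x′ ⊎-dec M? x′)) then filled x
    else if does (L? x ×-dec x ≺? x′) then filled x
    else if does (S? x ×-dec (S? x′ ⊎-dec M? x′) ×-dec x ≺? x′) then filled x
    else if does (M? x ×-dec M? x′ ×-dec x′ ≺? x) then filled x
    else filled x′
  rules₂ (pair s b) x = pair s b

  run : Rules → Instance → State
  run rules = foldl (step rules) (running empty)

  -- A legal move of an online algorithm that holds K when x arrives.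
  Legal : Multiset → Item → Multiset → Set (c ⊔ ℓ₁ ⊔ ℓ₂)
  Legal K x K′ = Update K x K′ × (weight K ≤ 1# → weight K′ ≤ 1#)

  stay : ∀ K x → Legal K x K
  stay K x = (0 , [] , ↭-reflexive (++-identityʳ _)) , λ p → p

  0≤size : ∀ x → 0# ≤ size x
  0≤size x = proj₁ (0<size x)

  size≉0 : ∀ x → ¬ size x ≈ 0#
  size≉0 x eq = proj₂ (0<size x) (≈-sym eq)

  weight-replicate : ∀ n x → weight (replicate n x) ≈ fromℕ n * size x
  weight-replicate zero    x = ≈-sym (zeroˡ (size x))
  weight-replicate (suc n) x = ≈-trans (+-congˡ (weight-replicate n x))
    (≈-sym (≈-trans (distribʳ (size x) 1# (fromℕ n)) (+-congʳ (*-identityˡ (size x)))))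

  weight-fill≤1 : ∀ x → weight (fill x) ≤ 1#
  weight-fill≤1 x = ≤-respˡ-≈ (≈-sym (weight-replicate ⌊ size x ⁻¹ ⌋ x))
    (≤-respʳ-≈ (≈-trans (*-comm _ _) (*-inverseʳ (size≉0 x)))
      (*-monoˡ-≤ (0≤size x)
        (floorUpTo≤ (proj₁ (archimedean (size x ⁻¹))) (0≤x⁻¹ (0≤size x) (size≉0 x)))))

  fill-nonempty : ∀ x → ∃[ k ] fill x ≡ x ∷ replicate k x
  fill-nonempty x with floorUpTo-positive (proj₁ arch) 1≤x⁻¹ (proj₂ arch)
    where
    arch = archimedean (size x ⁻¹)
    1≤x⁻¹ : 1# ≤ size x ⁻¹
    1≤x⁻¹ = ≤-respˡ-≈ (*-inverseʳ (size≉0 x))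
      (≤-respʳ-≈ (*-identityˡ _) (*-monoˡ-≤ (0≤x⁻¹ (0≤size x) (size≉0 x)) (size≤1 x)))
  ... | k , eq = k , cong (λ n → replicate n x) eq

  refill : ∀ K x → Legal K x (fill x)
  refill K x = (⌊ size x ⁻¹ ⌋ , K , ↭-refl) , λ _ → weight-fill≤1 x

  if-dec : ∀ {a p q} {A : Set a} {B : Set p} (P : B → Set q) (d : Dec A) {t e : B} →
           (A → P t) → P e → P (if does d then t else e)
  if-dec P (yes a) pt pe = pt a
  if-dec P (no  _) pt pe = pe

  weight-pair : ∀ x y → size x + size y ≤ 1# → weight (x ∷ y ∷ []) ≤ 1#
  weight-pair x y = ≤-respˡ-≈ (+-congˡ (≈-sym (+-identityʳ _)))

  combine : ∀ x x′ → size x + size x′ ≤ 1# →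
            Legal (fill x′) x (min x x′ ∷ max x x′ ∷ [])
  combine x x′ x+x′≤1 with fill-nonempty x′ | size x ≤? size x′
  ... | k , eq | yes _ = (1 , replicate k x′ , prep x (↭-reflexive (sym eq)))
                       , λ _ → weight-pair x x′ x+x′≤1
  ... | k , eq | no  _ = (1 , replicate k x′ ,
                           ↭-trans (swap x′ x ↭-refl) (prep x (↭-reflexive (sym eq))))
                       , λ _ → weight-pair x′ x (≤-respˡ-≈ (+-comm _ _) x+x′≤1)

  legal₁ : ∀ K x → Legal ⟦ K ⟧ x ⟦ rules₁ K x ⟧
  legal₁ empty x = refill [] x
  legal₁ (filled x′) x =
    let P = λ K → Legal (fill x′) x ⟦ K ⟧ in
    if-dec P (S? (min x x′) ×-dec (M? (max x x′) ⊎-dec L? (max x x′)) ×-dec size x + size x′ ≤? 1#)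
             (λ (_ , _ , p) → combine x x′ p)
   (if-dec P (S? x ×-dec x ≺? x′) (λ _ → refill (fill x′) x)
   (if-dec P (M? x ×-dec M? x′ ×-dec x′ ≺? x) (λ _ → refill (fill x′) x)
   (if-dec P (L? x′ ×-dec x ≺? x′) (λ _ → refill (fill x′) x)
    (stay (fill x′) x))))
  legal₁ (pair s b) x =
    let P = λ K → Legal (s ∷ b ∷ []) x ⟦ K ⟧ in
    if-dec P (x ≺? s)
             (λ (x≤s , _) → (1 , [ s ] , prep x (swap b s ↭-refl))
                          , ≤-trans (+-monoˡ-≤ _ x≤s))
   (if-dec P (b ≺? x ×-dec size x + size s ≤? 1#)
             (λ (_ , p) → (1 , [ b ] , swap s x ↭-refl)
                        , λ _ → weight-pair s x (≤-respˡ-≈ (+-comm _ _) p))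
    (stay (s ∷ b ∷ []) x))

  legal₂ : ∀ K x → Legal ⟦ K ⟧ x ⟦ rules₂ K x ⟧
  legal₂ empty x = refill [] x
  legal₂ (filled x′) x =
    let P = λ K → Legal (fill x′) x ⟦ K ⟧ in
    if-dec P (S? (min x x′) ×-dec L? (max x x′) ×-dec size x + size x′ ≤? 1#)
             (λ (_ , _ , p) → combine x x′ p)
   (if-dec P (L? x ×-dec (S? x′ ⊎-dec M? x′)) (λ _ → refill (fill x′) x)
   (if-dec P (L? x ×-dec x ≺? x′) (λ _ → refill (fill x′) x)
   (if-dec P (S? x ×-dec (S? x′ ⊎-dec M? x′) ×-dec x ≺? x′) (λ _ → refill (fill x′) x)
   (if-dec P (M? x ×-dec M? x′ ×-dec x′ ≺? x) (λ _ → refill (fill x′) x)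
    (stay (fill x′) x)))))
  legal₂ (pair s b) x = stay (s ∷ b ∷ []) x

  strategy : (rules : Rules) → (∀ K x → Legal ⟦ K ⟧ x ⟦ rules K x ⟧) → OnlineAlgorithm
  strategy rules legal = record
    { knapsack = λ I → contents (run rules I)
    ; initial  = refl
    ; update   = λ I x → subst (λ s → Update (contents (run rules I)) x (contents s))
                           (sym (foldl-∷ʳ (step rules) (running empty) x I))
                           (proj₁ (legal-step (run rules I) x))
    ; feasible = λ I → feasible-from (running empty) I 0≤1
    }
    where
    legal-step : ∀ s x → Legal (contents s) x (contents (step rules s x))
    legal-step (stopped y) x = stay (fill y) x
    legal-step (running K) x =
      if-dec (λ s → Legal ⟦ K ⟧ x (contents s)) (G? x) (λ _ → refill ⟦ K ⟧ x) (legal K x)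

    feasible-from : ∀ s I → weight (contents s) ≤ 1# →
                    weight (contents (foldl (step rules) s I)) ≤ 1#
    feasible-from s []      p = p
    feasible-from s (x ∷ I) p = feasible-from (step rules s x) I (proj₂ (legal-step s x) p)

  A₁ A₂ : OnlineAlgorithm
  A₁ = strategy rules₁ legal₁
  A₂ = strategy rules₂ legal₂

  RandChoice : RandomizedOnlineAlgorithm
  RandChoice = record
    { choices     = (1 / 2 , A₁) ∷ (1 / 2 , A₂) ∷ []
    ; nonNegative = 0≤1/2 ∷ 0≤1/2 ∷ []
    ; sum≈1       = 1/2+1/2≈1
    }

{-# OPTIONS --safe #-}
module Submission where

-- The ratio is exactly 4/3.  Once an item of G arrives both strategies stop
-- with gain at least 3/4, and the instance 3/4, 1 attains the ratio.  Without
-- items of G, every item exceeds 1/3, so a solution has at most two items, and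
-- it exceeds 3/4 only if it joins an item of S to one of M ∪ L.  Tracking both
-- strategies jointly, either no such two items fit together, or the two gains
-- add up to at least 3/2.  In the former case the gains add up to at least 9/8,
-- unless only items of M have arrived: then they exceed 1, and no solution
-- reaches 5/8.

open import Defs
import Algebra.Properties.CommutativeSemigroup as CommutativeSemigroupProperties
import Algebra.Properties.Ring as RingProperties
import Algebra.Properties.Semiring.Mult as SemiringMult
open import Data.Bool.Base using (if_then_else_)
open import Data.Empty using (⊥; ⊥-elim)
open import Data.List.Base using ([]; _∷_; _ʳ++_; foldl; replicate; reverse)
open import Data.List.Membership.Propositional using (_∈_)
open import Data.List.Relation.Unary.All as All using (All; []; _∷_)
open import Data.List.Relation.Unary.Any using (here; there)
open import Data.List.Relation.Unary.Any.Properties using (reverse⁺)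
import Data.Nat.Base as ℕ
open import Data.Nat.Base using (ℕ; zero; suc; NonZero)
import Data.Nat.Properties as ℕ
open import Data.Product.Base using (∃-syntax; _×_; _,_; proj₁; proj₂)
open import Data.Sum.Base as Sum using (_⊎_; inj₁; inj₂)
open import Function.Base using (_∘_)
open import Level using (_⊔_)
open import Relation.Binary.Bundles using (DecTotalOrder)
import Relation.Binary.Properties.DecTotalOrder as DecTotalOrderProperties
import Relation.Binary.Reasoning.PartialOrder as PartialOrderReasoning
open import Relation.Binary.PropositionalEquality
  using (_≡_; refl; sym; trans; cong; subst; subst₂)
open import Relation.Nullary using (¬_; Dec; yes; no; does; contradiction)
open import Relation.Nullary.Decidable using (True; toWitness; toSum; _×-dec_; _⊎-dec_)
open import Relation.Unary using (Pred)

-- A joint state whose two gains always reach 3/2 = 36/24 needs no record of the past, because no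
-- solution exceeds 1; only the other states constrain the arrived items. The critical state is
-- `SB-L`: the category bounds 8/24, 12/24 and 15/24 of `s`, `b` and `l` add up to 35/24 only. What
-- rescues it is the way it arises: either `s` and `l` together exceed 1, which with `b` above 1/2
-- gives 3/2, or `l` is at most `b`, so that `b` too is at least 5/8. A lower bound belongs to the
-- proof because `R` need not be complete: the infimum has to be exhibited, here by its exact value.

module Arithmetic {c ℓ₁ ℓ₂} (R : ArchimedeanOrderedField c ℓ₁ ℓ₂) where
  open ArchimedeanOrderedField R
  open OrderedFieldProperties R
  open RingProperties ring using (+-cancelʳ; +-cancelˡ)
  open SemiringMult semiring using (×-homo-+; ×1-homo-*)
  open CommutativeSemigroupProperties *-commutativeSemigroup using (xy∙z≈xz∙y)
  open DecTotalOrderProperties decTotalOrder public using (≮⇒≥; ≰⇒>; <⇒≱)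
  open PartialOrderReasoning (DecTotalOrder.poset decTotalOrder)

  -- Monotonicity and cancellation in an ordered field

  +-mono-≤ : ∀ {w x y z} → w ≤ x → y ≤ z → w + y ≤ x + z
  +-mono-≤ w≤x y≤z = ≤-trans (+-monoˡ-≤ _ w≤x) (+-monoʳ-≤ _ y≤z)

  +-monoˡ-< : ∀ {x y} z → x < y → x + z < y + z
  +-monoˡ-< z (x≤y , x≉y) = +-monoˡ-≤ z x≤y , x≉y ∘ +-cancelʳ z _ _

  +-mono-<-≤ : ∀ {w x y z} → w < x → y ≤ z → w + y < x + z
  +-mono-<-≤ {w} {x} {y} {z} w<x y≤z = begin-strict
    w + y <⟨ +-monoˡ-< y w<x ⟩
    x + y ≤⟨ +-monoʳ-≤ x y≤z ⟩
    x + z ∎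

  +-cancelˡ-≤ : ∀ x {y z} → x + y ≤ x + z → y ≤ z
  +-cancelˡ-≤ x {y} {z} p with y ≤? z
  ... | yes y≤z = y≤z
  ... | no  y≰z = contradiction (antisym p (+-monoʳ-≤ x (proj₁ z<y)))
                    (λ eq → proj₂ z<y (≈-sym (+-cancelˡ x y z eq)))
    where
    z<y = ≰⇒> y≰z

  *-monoʳ-≤ : ∀ {x y z} → 0# ≤ z → x ≤ y → z * x ≤ z * y
  *-monoʳ-≤ {x} {y} {z} 0≤z x≤y = begin
    z * x ≈⟨ *-comm z x ⟩
    x * z ≤⟨ *-monoˡ-≤ 0≤z x≤y ⟩
    y * z ≈⟨ *-comm y z ⟩
    z * y ∎

  *-cancelʳ-≤ : ∀ {x y z} → 0# ≤ z → ¬ z ≈ 0# → x * z ≤ y * z → x ≤ y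
  *-cancelʳ-≤ {x} {y} {z} 0≤z z≉0 p = begin
    x               ≈⟨ cancel x ⟨
    x * z * z ⁻¹    ≤⟨ *-monoˡ-≤ (0≤x⁻¹ 0≤z z≉0) p ⟩
    y * z * z ⁻¹    ≈⟨ cancel y ⟩
    y               ∎
    where
    cancel : ∀ w → w * z * z ⁻¹ ≈ w
    cancel w = ≈-trans (*-assoc w z (z ⁻¹))
      (≈-trans (*-congˡ (*-inverseʳ z≉0)) (*-identityʳ w))

  -- Natural numbers in the field and the floor function

  fromℕ-mono-≤ : ∀ {m n} → m ℕ.≤ n → fromℕ m ≤ fromℕ n
  fromℕ-mono-≤ {n = n} ℕ.z≤n = 0≤fromℕ n
  fromℕ-mono-≤ (ℕ.s≤s m≤n)   = +-monoʳ-≤ 1# (fromℕ-mono-≤ m≤n)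

  fromℕ<suc : ∀ n → fromℕ n < fromℕ (suc n)
  fromℕ<suc n = fromℕ-mono-≤ (ℕ.n≤1+n n) , λ eq →
    0≉1 (+-cancelʳ (fromℕ n) 0# 1# (≈-trans (+-identityˡ _) eq))

  fromℕ-mono-< : ∀ {m n} → m ℕ.< n → fromℕ m < fromℕ n
  fromℕ-mono-< {m} {n} m<n = begin-strict
    fromℕ m       <⟨ fromℕ<suc m ⟩
    fromℕ (suc m) ≤⟨ fromℕ-mono-≤ m<n ⟩
    fromℕ n       ∎

  -- The search descends, and each failed comparison with `suc n` supplies the hypothesis for the
  -- next call.
  <suc-floorUpTo : ∀ n {x} → x < fromℕ (suc n) → x < fromℕ (suc (floorUpTo n x))
  <suc-floorUpTo zero    p = p
  <suc-floorUpTo (suc n) {x} p with fromℕ (suc n) ≤? x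
  ... | yes _ = p
  ... | no  q = <suc-floorUpTo n (≰⇒> q)

  <suc-⌊⌋ : ∀ x → x < fromℕ (suc ⌊ x ⌋)
  <suc-⌊⌋ x = <suc-floorUpTo n (begin-strict
    x             ≤⟨ proj₂ (archimedean x) ⟩
    fromℕ n       <⟨ fromℕ<suc n ⟩
    fromℕ (suc n) ∎)
    where
    n = proj₁ (archimedean x)

  ≤⇒≤⌊⌋ : ∀ n {x} → fromℕ n ≤ x → n ℕ.≤ ⌊ x ⌋
  ≤⇒≤⌊⌋ n {x} p = ℕ.≮⇒≥ λ q →
    <⇒≱ (<suc-⌊⌋ x) (≤-trans (fromℕ-mono-≤ q) p)

  -- Fractions and multiples of 1/24

  /-cleared : ∀ m n .{{_ : NonZero n}} → m / n * fromℕ n ≈ fromℕ m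
  /-cleared m (suc n) = begin-equality
    fromℕ m * fromℕ (suc n) ⁻¹ * fromℕ (suc n)     ≈⟨ *-assoc _ _ _ ⟩
    fromℕ m * (fromℕ (suc n) ⁻¹ * fromℕ (suc n))   ≈⟨ *-congˡ (*-comm _ _) ⟩
    fromℕ m * (fromℕ (suc n) * fromℕ (suc n) ⁻¹)   ≈⟨ *-congˡ (*-inverseʳ (fromℕ≉0 n)) ⟩
    fromℕ m * 1#                                   ≈⟨ *-identityʳ _ ⟩
    fromℕ m                                        ∎

  /-mono-≤ : ∀ m n p q .{{_ : NonZero n}} .{{_ : NonZero q}} →
             m ℕ.* q ℕ.≤ p ℕ.* n → m / n ≤ p / q
  /-mono-≤ m n@(suc n-1) p q@(suc q-1) mq≤pn =
    *-cancelʳ-≤ (0≤fromℕ n) (fromℕ≉0 n-1)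
      (*-cancelʳ-≤ (0≤fromℕ q) (fromℕ≉0 q-1) (begin
        m / n * fromℕ n * fromℕ q ≈⟨ *-congʳ (/-cleared m n) ⟩
        fromℕ m * fromℕ q         ≈⟨ ×1-homo-* m q ⟨
        fromℕ (m ℕ.* q)           ≤⟨ fromℕ-mono-≤ mq≤pn ⟩
        fromℕ (p ℕ.* n)           ≈⟨ ×1-homo-* p n ⟩
        fromℕ p * fromℕ n         ≈⟨ *-congʳ (/-cleared p q) ⟨
        p / q * fromℕ q * fromℕ n ≈⟨ xy∙z≈xz∙y (p / q) (fromℕ q) (fromℕ n) ⟩
        p / q * fromℕ n * fromℕ q ∎))

  -- All thresholds of the algorithm and all bounds of its analysis are
  -- multiples of 1/24.  Opacity lets numerators be inferred by unification.
  infix 8 _/24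
  opaque
    _/24 : ℕ → Carrier
    k /24 = k / 24

    /24-cleared : ∀ k → k /24 * fromℕ 24 ≈ fromℕ k
    /24-cleared k = /-cleared k 24

    /≈/24 : ∀ m n k .{{_ : NonZero n}} {_ : True (m ℕ.* 24 ℕ.≟ k ℕ.* n)} → m / n ≈ k /24
    /≈/24 m n k {eq} = antisym
      (/-mono-≤ m n k 24 (ℕ.≤-reflexive (toWitness eq)))
      (/-mono-≤ k 24 m n (ℕ.≤-reflexive (sym (toWitness eq))))

    +-/24 : ∀ {m n} → (m ℕ.+ n) /24 ≈ m /24 + n /24
    +-/24 {m} {n} = ≈-trans (*-congʳ (×-homo-+ 1# m n)) (distribʳ _ _ _)

    *-/24 : ∀ m {n} → (m ℕ.* n) /24 ≈ fromℕ m * n /24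
    *-/24 m {n} = ≈-trans (*-congʳ (×1-homo-* m n)) (*-assoc _ _ _)

    /24-mono-≤ : ∀ {m n} → m ℕ.≤ n → m /24 ≤ n /24
    /24-mono-≤ {m} {n} m≤n = /-mono-≤ m 24 n 24 (ℕ.*-monoˡ-≤ 24 m≤n)

  /24-mono-< : ∀ {m n} → m ℕ.< n → m /24 < n /24
  /24-mono-< {m} {n} m<n = /24-mono-≤ (ℕ.<⇒≤ m<n) , λ eq → proj₂ (fromℕ-mono-< m<n)
    (≈-trans (≈-sym (/24-cleared m)) (≈-trans (*-congʳ eq) (/24-cleared n)))

  1≈24/24 : 1# ≈ 24 /24
  1≈24/24 = begin-equality
    1#            ≈⟨ *-inverseʳ (fromℕ≉0 0) ⟨
    fromℕ 1 * fromℕ 1 ⁻¹ ≈⟨ /≈/24 1 1 24 ⟩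
    24 /24        ∎

  0≈0/24 : 0# ≈ 0 /24
  0≈0/24 = ≈-trans (≈-sym (zeroˡ _)) (/≈/24 0 1 0)

  -- The numerators `m` and `n` are found by unification with the hypotheses; for numerals, the
  -- comparison in the implicit `True` argument is solved by evaluation.
  +-lower : ∀ {i m n x y} → m /24 ≤ x → n /24 ≤ y → {_ : True (i ℕ.≤? m ℕ.+ n)} → i /24 ≤ x + y
  +-lower p q {i≤m+n} = ≤-trans (/24-mono-≤ (toWitness i≤m+n)) (≤-respˡ-≈ (≈-sym +-/24) (+-mono-≤ p q))

  +-upper : ∀ {k m n x y} → x ≤ m /24 → y ≤ n /24 → {_ : True (m ℕ.+ n ℕ.≤? k)} → x + y ≤ k /24
  +-upper p q {m+n≤k} = ≤-trans (≤-respʳ-≈ (≈-sym +-/24) (+-mono-≤ p q)) (/24-mono-≤ (toWitness m+n≤k))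

  ≤1⇐ : ∀ {x} → x ≤ 24 /24 → x ≤ 1#
  ≤1⇐ = ≤-respʳ-≈ (≈-sym 1≈24/24)

  -- One strict summand is enough, so the numerators may add up to exactly 24, as they do for two
  -- items above 1/2 and for three above 1/3.
  +-exceeds-1 : ∀ {m n x y} → m /24 < x → n /24 ≤ y → {_ : True (24 ℕ.≤? m ℕ.+ n)} → ¬ x + y ≤ 1#
  +-exceeds-1 {m} {n} {x} {y} p q {24≤m+n} = <⇒≱ (begin-strict
    1#              ≈⟨ 1≈24/24 ⟩
    24 /24          ≤⟨ /24-mono-≤ (toWitness 24≤m+n) ⟩
    (m ℕ.+ n) /24   ≈⟨ +-/24 ⟩
    m /24 + n /24   <⟨ +-mono-<-≤ p q ⟩
    x + y           ∎)

  -- The right side is 4/3 of the mean gain in the form to which `expectedGain` unfolds, hence the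
  -- trailing `0#`. Two thirds of `n` is at least `m` if `3 * m ≤ 2 * n`; the proof clears the
  -- denominators 3 and 2.
  ≤4/3*mean : ∀ {m n x y z} → x ≤ m /24 → n /24 ≤ y + z → {_ : True (3 ℕ.* m ℕ.≤? 2 ℕ.* n)} →
              x ≤ 4 / 3 * (1 / 2 * y + (1 / 2 * z + 0#))
  ≤4/3*mean {m} {n} {x} {y} {z} x≤m n≤y+z {3m≤2n} = ≤-trans x≤m
    (*-cancelʳ-≤ (0≤fromℕ 6) (fromℕ≉0 5) (begin
      m /24 * fromℕ 6                                          ≈⟨ *-comm _ _ ⟩
      fromℕ 6 * m /24                                          ≈⟨ *-/24 6 ⟨
      (6 ℕ.* m) /24                                            ≤⟨ /24-mono-≤ 6m≤4n ⟩
      (4 ℕ.* n) /24                                            ≈⟨ *-/24 4 ⟩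
      fromℕ 4 * n /24                                          ≤⟨ *-monoʳ-≤ (0≤fromℕ 4) n≤y+z ⟩
      fromℕ 4 * (y + z)                                        ≈⟨ *-congˡ halves ⟨
      fromℕ 4 * (mean * fromℕ 2)                               ≈⟨ *-congʳ (/-cleared 4 3) ⟨
      4 / 3 * fromℕ 3 * (mean * fromℕ 2)                       ≈⟨ *-interchange _ _ _ _ ⟩
      4 / 3 * mean * (fromℕ 3 * fromℕ 2)                       ≈⟨ *-congˡ (×1-homo-* 3 2) ⟨
      4 / 3 * mean * fromℕ 6                                   ∎))
    where
    open CommutativeSemigroupProperties *-commutativeSemigroup
      using () renaming (interchange to *-interchange)
    mean = 1 / 2 * y + (1 / 2 * z + 0#)
    6m≤4n : 6 ℕ.* m ℕ.≤ 4 ℕ.* n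
    6m≤4n = ℕ.≤-trans (ℕ.≤-reflexive (ℕ.*-assoc 2 3 m))
      (ℕ.≤-trans (ℕ.*-monoʳ-≤ 2 (toWitness 3m≤2n)) (ℕ.≤-reflexive (sym (ℕ.*-assoc 2 2 n))))
    halves : mean * fromℕ 2 ≈ y + z
    halves = begin-equality
      mean * fromℕ 2                  ≈⟨ *-congʳ (+-congˡ (+-identityʳ _)) ⟩
      (1 / 2 * y + 1 / 2 * z) * fromℕ 2 ≈⟨ *-congʳ (distribˡ _ _ _) ⟨
      1 / 2 * (y + z) * fromℕ 2       ≈⟨ xy∙z≈xz∙y _ _ _ ⟩
      1 / 2 * fromℕ 2 * (y + z)       ≈⟨ *-congʳ (/-cleared 1 2) ⟩
      fromℕ 1 * (y + z)               ≈⟨ *-congʳ (+-identityʳ 1#) ⟩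
      1# * (y + z)                    ≈⟨ *-identityˡ _ ⟩
      y + z                           ∎

module Analysis {c ℓ₁ ℓ₂} (R : ArchimedeanOrderedField c ℓ₁ ℓ₂) where
  open ArchimedeanOrderedField R
  open OrderedFieldProperties R
  open Arithmetic R
  open Knapsack R
  open CommutativeSemigroupProperties +-commutativeSemigroup using (xy∙z≈xz∙y)
  open PartialOrderReasoning (DecTotalOrder.poset decTotalOrder)

  -- Item categories and which items fit together

  Fits : Item → Item → Set ℓ₂
  Fits x y = size x + size y ≤ 1#

  Fits-sym : ∀ x y → Fits x y → Fits y x
  Fits-sym x y = ≤-respˡ-≈ (+-comm _ _)

  M∪L : Pred Item (ℓ₁ ⊔ ℓ₂)
  M∪L x = M x ⊎ L x

  S-bounds : ∀ x → S x → 8 /24 < size x × size x < 9 /24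
  S-bounds x (p , q) =
    (begin-strict 8 /24 ≈⟨ /≈/24 1 3 8 ⟨ 1 / 3 <⟨ p ⟩ size x ∎) ,
    (begin-strict size x <⟨ q ⟩ 3 / 8 ≈⟨ /≈/24 3 8 9 ⟩ 9 /24 ∎)

  M-bounds : ∀ x → M x → 12 /24 < size x × size x < 15 /24
  M-bounds x (p , q) =
    (begin-strict 12 /24 ≈⟨ /≈/24 1 2 12 ⟨ 1 / 2 <⟨ p ⟩ size x ∎) ,
    (begin-strict size x <⟨ q ⟩ 5 / 8 ≈⟨ /≈/24 5 8 15 ⟩ 15 /24 ∎)

  L-bounds : ∀ x → L x → 15 /24 ≤ size x × size x < 18 /24
  L-bounds x (p , q) =
    (begin 15 /24 ≈⟨ /≈/24 5 8 15 ⟨ 5 / 8 ≤⟨ p ⟩ size x ∎) ,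
    (begin-strict size x <⟨ q ⟩ 3 / 4 ≈⟨ /≈/24 3 4 18 ⟩ 18 /24 ∎)

  S-lower : ∀ x → S x → 8 /24 ≤ size x
  S-lower x = proj₁ ∘ proj₁ ∘ S-bounds x

  S-upper : ∀ x → S x → size x ≤ 9 /24
  S-upper x = proj₁ ∘ proj₂ ∘ S-bounds x

  M-lower : ∀ x → M x → 12 /24 ≤ size x
  M-lower x = proj₁ ∘ proj₁ ∘ M-bounds x

  M-upper : ∀ x → M x → size x ≤ 15 /24
  M-upper x = proj₁ ∘ proj₂ ∘ M-bounds x

  L-lower : ∀ x → L x → 15 /24 ≤ size x
  L-lower x = proj₁ ∘ L-bounds x

  L-upper : ∀ x → L x → size x ≤ 18 /24
  L-upper x = proj₁ ∘ proj₂ ∘ L-bounds x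

  M∪L-lower : ∀ x → M∪L x → 12 /24 < size x
  M∪L-lower x (inj₁ m) = proj₁ (M-bounds x m)
  M∪L-lower x (inj₂ l) = begin-strict
    12 /24 <⟨ /24-mono-< (ℕ.m≤m+n 13 2) ⟩
    15 /24 ≤⟨ L-lower x l ⟩
    size x ∎

  M∪L-upper : ∀ x → M∪L x → size x ≤ 18 /24
  M∪L-upper x (inj₁ m) = ≤-trans (M-upper x m) (/24-mono-≤ (ℕ.m≤m+n 15 3))
  M∪L-upper x (inj₂ l) = L-upper x l

  classify : ∀ x → ¬ G x → S x ⊎ M x ⊎ L x
  classify x ¬g with size x <? 3 / 8 | size x <? 5 / 8
  ... | yes p | _ = inj₁ (≰⇒> (λ q → ¬g (inj₁ (0≤size x , q))) , p)
  ... | no p | yes q = inj₂ (inj₁ (≰⇒> (λ r → ¬g (inj₂ (inj₁ (≮⇒≥ p , r)))) , q))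
  ... | no p | no q = inj₂ (inj₂ (≮⇒≥ q , ≰⇒> (λ r → ¬g (inj₂ (inj₂ (r , size≤1 x))))))

  above-1/3 : ∀ x → S x ⊎ M∪L x → 8 /24 < size x
  above-1/3 x (inj₁ s) = proj₁ (S-bounds x s)
  above-1/3 x (inj₂ b) = begin-strict
    8 /24  ≤⟨ /24-mono-≤ (ℕ.m≤m+n 8 4) ⟩
    12 /24 <⟨ M∪L-lower x b ⟩
    size x ∎

  below-3/4 : ∀ x → S x ⊎ M∪L x → size x ≤ 18 /24
  below-3/4 x (inj₁ s) = ≤-trans (S-upper x s) (/24-mono-≤ (ℕ.m≤m+n 9 9))
  below-3/4 x (inj₂ b) = M∪L-upper x b

  S<M∪L : ∀ x y → S x → M∪L y → size x < size y
  S<M∪L x y s b = begin-strict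
    size x ≤⟨ S-upper x s ⟩
    9 /24  ≤⟨ /24-mono-≤ (ℕ.m≤m+n 9 3) ⟩
    12 /24 <⟨ M∪L-lower y b ⟩
    size y ∎

  M<L : ∀ x y → M x → L y → size x < size y
  M<L x y m l = begin-strict
    size x <⟨ proj₂ (M-bounds x m) ⟩
    15 /24 ≤⟨ L-lower y l ⟩
    size y ∎

  <-irreflexive : ∀ {x} → ¬ x < x
  <-irreflexive p = proj₂ p ≈-refl

  S⇒¬M∪L : ∀ x → S x → ¬ M∪L x
  S⇒¬M∪L x s b = <-irreflexive (S<M∪L x x s b)

  M⇒¬L : ∀ x → M x → ¬ L x
  M⇒¬L x m l = <-irreflexive (M<L x x m l)

  -- The upper ends 3/8 of `S` and 5/8 of `M` are complementary, so A₁ can always pair such items.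
  S-fits-M : ∀ x y → S x → M y → Fits x y
  S-fits-M x y s m = ≤1⇐ (+-upper (S-upper x s) (M-upper y m))

  M∪L-unfit : ∀ x y → M∪L x → M∪L y → ¬ Fits x y
  M∪L-unfit x y b b′ = +-exceeds-1 (M∪L-lower x b) (proj₁ (M∪L-lower y b′))

  -- Gains

  -- The upper bound `k` shows that `n` copies fit, so the floor is at least `n`; the lower bound
  -- `m` then measures these copies.
  fill-gain : ∀ {i} n {m k} x → m /24 ≤ size x → size x ≤ k /24 →
              {_ : True (n ℕ.* k ℕ.≤? 24)} → {_ : True (i ℕ.≤? n ℕ.* m)} → i /24 ≤ gain (fill x)
  fill-gain {i} n {m} {k} x m≤x x≤k {nk≤24} {i≤nm} = begin
    i /24                        ≤⟨ /24-mono-≤ (toWitness i≤nm) ⟩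
    (n ℕ.* m) /24                ≈⟨ *-/24 n ⟩
    fromℕ n * m /24              ≤⟨ *-monoʳ-≤ (0≤fromℕ n) m≤x ⟩
    fromℕ n * size x             ≤⟨ *-monoˡ-≤ (0≤size x) (fromℕ-mono-≤ (≤⇒≤⌊⌋ n n≤1/x)) ⟩
    fromℕ ⌊ size x ⁻¹ ⌋ * size x ≈⟨ weight-replicate ⌊ size x ⁻¹ ⌋ x ⟨
    gain (fill x)                ∎
    where
    n≤1/x : fromℕ n ≤ size x ⁻¹
    n≤1/x = *-cancelʳ-≤ (0≤size x) (size≉0 x) (begin
      fromℕ n * size x    ≤⟨ *-monoʳ-≤ (0≤fromℕ n) x≤k ⟩
      fromℕ n * k /24     ≈⟨ *-/24 n ⟨
      (n ℕ.* k) /24       ≤⟨ /24-mono-≤ (toWitness nk≤24) ⟩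
      24 /24              ≈⟨ 1≈24/24 ⟨
      1#                  ≈⟨ *-inverseʳ (size≉0 x) ⟨
      size x * size x ⁻¹  ≈⟨ *-comm _ _ ⟩
      size x ⁻¹ * size x  ∎)

  -- The floor of the inverse plus one exceeds the inverse, so one further copy brings the weight to
  -- at least 1.
  fill-gap : ∀ x → 1# ≤ size x + gain (fill x)
  fill-gap x = begin
    1#                                    ≈⟨ *-inverseʳ (size≉0 x) ⟨
    size x * size x ⁻¹                    ≈⟨ *-comm _ _ ⟩
    size x ⁻¹ * size x                    ≤⟨ *-monoˡ-≤ (0≤size x) (proj₁ (<suc-⌊⌋ _)) ⟩
    fromℕ (suc ⌊ size x ⁻¹ ⌋) * size x    ≈⟨ weight-replicate (suc ⌊ size x ⁻¹ ⌋) x ⟨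
    size x + gain (fill x)                ∎

  G-gain : ∀ x → G x → 18 /24 ≤ gain (fill x)
  -- Above 1/4, three copies fit and weigh more than 3/4; up to 1/4, the space left free by `fill x`
  -- is at most `size x`, hence at most 1/4.
  G-gain x (inj₁ (_ , x≤1/3)) with size x ≤? 6 /24
  ... | no x≰6/24 = fill-gain 3 x (proj₁ (≰⇒> x≰6/24)) (≤-respʳ-≈ (/≈/24 1 3 8) x≤1/3)
  ... | yes x≤6/24 = +-cancelˡ-≤ (6 /24) (begin
    6 /24 + 18 /24         ≈⟨ +-/24 ⟨
    24 /24                 ≈⟨ 1≈24/24 ⟨
    1#                     ≤⟨ fill-gap x ⟩
    size x + gain (fill x) ≤⟨ +-monoˡ-≤ _ x≤6/24 ⟩
    6 /24 + gain (fill x)  ∎)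
  G-gain x (inj₂ (inj₁ (p , q))) =
    fill-gain 2 x (≤-respˡ-≈ (/≈/24 3 8 9) p) (≤-respʳ-≈ (/≈/24 1 2 12) q)
  G-gain x (inj₂ (inj₂ (p , q))) =
    fill-gain 1 x (≤-respˡ-≈ (/≈/24 3 4 18) p) (≤-respʳ-≈ 1≈24/24 q)

  S-gain : ∀ x → S x → 16 /24 ≤ gain (fill x)
  S-gain x s = fill-gain 2 x (S-lower x s) (S-upper x s)

  M-gain : ∀ x → M x → 12 /24 ≤ gain (fill x)
  M-gain x m = fill-gain 1 x (M-lower x m) (M-upper x m)

  L-gain : ∀ x → L x → 15 /24 ≤ gain (fill x)
  L-gain x l = fill-gain 1 x (L-lower x l) (L-upper x l)

  gain-pair : ∀ x y → gain (x ∷ y ∷ []) ≈ size x + size y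
  gain-pair x y = +-congˡ (+-identityʳ (size y))

  pair-gain : ∀ {i m n} x y → m /24 ≤ size x → n /24 ≤ size y →
              {_ : True (i ℕ.≤? m ℕ.+ n)} → i /24 ≤ gain (x ∷ y ∷ [])
  pair-gain x y p q {i≤m+n} = ≤-respʳ-≈ (≈-sym (gain-pair x y)) (+-lower p q {i≤m+n})

  0≤weight : ∀ T → 0# ≤ weight T
  0≤weight []      = ≤-refl
  0≤weight (x ∷ T) = ≤-respˡ-≈ (+-identityˡ 0#) (+-mono-≤ (0≤size x) (0≤weight T))

  -- `P` stands for what a joint state knows of every arrived item. The last condition concerns only
  -- pairs that fit, so it can also be met by showing that there are none.
  solution-bound : ∀ {p} {P : Pred Item p} {m} →
                   (∀ x → P x → S x ⊎ M∪L x) →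
                   (∀ x → P x → size x ≤ m /24) →
                   (∀ x y → P x → P y → Fits x y → size x + size y ≤ m /24) →
                   ∀ T → All P T → weight T ≤ 1# → weight T ≤ m /24
  solution-bound cat one two [] _ _ = ≤-respˡ-≈ (≈-sym 0≈0/24) (/24-mono-≤ ℕ.z≤n)
  solution-bound cat one two (x ∷ []) (px ∷ _) _ = ≤-respˡ-≈ (≈-sym (+-identityʳ _)) (one x px)
  solution-bound cat one two (x ∷ y ∷ []) (px ∷ py ∷ _) p =
    ≤-respˡ-≈ (≈-sym (gain-pair x y)) (two x y px py (≤-respˡ-≈ (gain-pair x y) p))
  solution-bound cat one two (x ∷ y ∷ z ∷ T) (px ∷ py ∷ pz ∷ _) p = contradiction p
    (+-exceeds-1 {n = 16} (above-1/3 x (cat x px))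
      (+-lower (proj₁ (above-1/3 y (cat y py)))
        (+-lower {i = 8} (proj₁ (above-1/3 z (cat z pz))) (≤-respˡ-≈ 0≈0/24 (0≤weight T)))))

  -- Serves the bound for `SB-L`, where `l` has to enter with its exact size instead of a multiple
  -- of 1/24.
  size≤gain-fill : ∀ x → size x ≤ gain (fill x)
  size≤gain-fill x with fill-nonempty x
  ... | k , eq = subst (λ T → size x ≤ weight T) (sym eq)
    (≤-respˡ-≈ (+-identityʳ (size x)) (+-monoʳ-≤ (size x) (0≤weight (replicate k x))))

  -- Evaluation of the rules

  S⇒¬M : ∀ x → S x → ¬ M x
  S⇒¬M x s m = S⇒¬M∪L x s (inj₁ m)

  S⇒¬L : ∀ x → S x → ¬ L x
  S⇒¬L x s l = S⇒¬M∪L x s (inj₂ l)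

  M⇒¬S : ∀ x → M x → ¬ S x
  M⇒¬S x m s = S⇒¬M x s m

  L⇒¬S : ∀ x → L x → ¬ S x
  L⇒¬S x l s = S⇒¬L x s l

  L⇒¬M : ∀ x → L x → ¬ M x
  L⇒¬M x l m = M⇒¬L x m l

  module _ {a} {A : Set a} where

    if-elim : ∀ {b p} {B : Set b} (P : B → Set p) (d : Dec A) {t e : B} →
              (A → P t) → (¬ A → P e) → P (if does d then t else e)
    if-elim P (yes a) pt pe = pt a
    if-elim P (no ¬a) pt pe = pe ¬a

    if-elim₂ : ∀ {b c p} {B : Set b} {C : Set c} (P : B → C → Set p) (d : Dec A)
               {t e : B} {t′ e′ : C} → (A → P t t′) → (¬ A → P e e′) →
               P (if does d then t else e) (if does d then t′ else e′)
    if-elim₂ P (yes a) pt pe = pt a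
    if-elim₂ P (no ¬a) pt pe = pe ¬a

    when : ∀ {b} {B : Set b} (d : Dec A) {t e : B} → A → (if does d then t else e) ≡ t
    when d {t} a = if-elim (_≡ t) d (λ _ → refl) (contradiction a)

    unless : ∀ {b} {B : Set b} (d : Dec A) {t e r : B} → ¬ A → e ≡ r →
             (if does d then t else e) ≡ r
    unless d {r = r} ¬a e≡r = if-elim (_≡ r) d (λ a → contradiction a ¬a) (λ _ → e≡r)

    -- For items of fixed categories the guard `d₁` of a rule reduces to its size comparison `d₂`,
    -- and the later rules `r` agree with the failing branch. This turns a chain of rules into
    -- `lesser` or `greater`.
    select : ∀ {b c d} {B : Set b} {C : Set c} {D : Set d} (f : C → D) (d₁ : Dec A) (d₂ : Dec B)
             {t e : C} {r : D} → (A → B) → (B → A) → r ≡ f e →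
             (if does d₁ then f t else r) ≡ f (if does d₂ then t else e)
    select f (yes a) (yes b) to from r≡fe = refl
    select f (yes a) (no ¬b) to from r≡fe = contradiction (to a) ¬b
    select f (no ¬a) (yes b) to from r≡fe = contradiction (from b) ¬a
    select f (no ¬a) (no ¬b) to from r≡fe = r≡fe

  -- The comparison is strict as in the replacement rules, so a tie keeps the second argument, the
  -- held item; `min` and `max` compare by `_≤_`.
  lesser greater : Item → Item → Item
  lesser  x y = if does (x ≺? y) then x else y
  greater x y = if does (y ≺? x) then x else y

  lesser-elim : ∀ {p} (P : Pred Item p) x y → P x → P y → P (lesser x y)
  lesser-elim P x y px py = if-elim P (x ≺? y) (λ _ → px) (λ _ → py)

  greater-elim : ∀ {p} (P : Pred Item p) x y → P x → P y → P (greater x y)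
  greater-elim P x y px py = if-elim P (y ≺? x) (λ _ → px) (λ _ → py)

  lesser≤ˡ : ∀ x y → size (lesser x y) ≤ size x
  lesser≤ˡ x y = if-elim (λ z → size z ≤ size x) (x ≺? y) (λ _ → ≤-refl) ≮⇒≥

  lesser≤ʳ : ∀ x y → size (lesser x y) ≤ size y
  lesser≤ʳ x y = if-elim (λ z → size z ≤ size y) (x ≺? y) proj₁ (λ _ → ≤-refl)

  min-≡ˡ : ∀ x y → size x < size y → min x y ≡ x
  min-≡ˡ x y p = when (size x ≤? size y) (proj₁ p)

  max-≡ʳ : ∀ x y → size x < size y → max x y ≡ y
  max-≡ʳ x y p = when (size x ≤? size y) (proj₁ p)

  min-≡ʳ : ∀ x y → size y < size x → min x y ≡ y
  min-≡ʳ x y p = unless (size x ≤? size y) (<⇒≱ p) refl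

  max-≡ˡ : ∀ x y → size y < size x → max x y ≡ x
  max-≡ˡ x y p = unless (size x ≤? size y) (<⇒≱ p) refl

  min-elim : ∀ {p} (P : Pred Item p) x y → P x → P y → P (min x y)
  min-elim P x y px py = if-elim P (size x ≤? size y) (λ _ → px) (λ _ → py)

  max-elim : ∀ {p} (P : Pred Item p) x y → P x → P y → P (max x y)
  max-elim P x y px py = if-elim P (size x ≤? size y) (λ _ → py) (λ _ → px)

  -- The guard of rule (1) in both strategies: `B` is `M∪L` for A₁ and `L` for A₂.
  Pairs : Pred Item (ℓ₁ ⊔ ℓ₂) → Item → Item → Set (ℓ₁ ⊔ ℓ₂)
  Pairs B x y = S (min x y) × B (max x y) × Fits x y

  pairs₁? : ∀ x y → Dec (Pairs M∪L x y)
  pairs₁? x y = S? (min x y) ×-dec (M? (max x y) ⊎-dec L? (max x y)) ×-dec size x + size y ≤? 1#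

  pairs₂? : ∀ x y → Dec (Pairs L x y)
  pairs₂? x y = S? (min x y) ×-dec L? (max x y) ×-dec size x + size y ≤? 1#

  module _ (B : Pred Item (ℓ₁ ⊔ ℓ₂)) where

    pairs-< : ∀ x y → size x < size y → S x → B y → Fits x y → Pairs B x y
    pairs-< x y p sx by fits =
      subst S (sym (min-≡ˡ x y p)) sx , subst B (sym (max-≡ʳ x y p)) by , fits

    pairs-> : ∀ x y → size y < size x → S y → B x → Fits x y → Pairs B x y
    pairs-> x y p sy bx fits =
      subst S (sym (min-≡ʳ x y p)) sy , subst B (sym (max-≡ˡ x y p)) bx , fits

    ¬S⇒¬pairs : ∀ x y → ¬ S x → ¬ S y → ¬ Pairs B x y
    ¬S⇒¬pairs x y ¬sx ¬sy = min-elim (¬_ ∘ S) x y ¬sx ¬sy ∘ proj₁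

    ¬B⇒¬pairs : ∀ x y → ¬ B x → ¬ B y → ¬ Pairs B x y
    ¬B⇒¬pairs x y ¬bx ¬by = max-elim (¬_ ∘ B) x y ¬bx ¬by ∘ proj₁ ∘ proj₂

    unfit⇒¬pairs : ∀ x y → ¬ Fits x y → ¬ Pairs B x y
    unfit⇒¬pairs x y ¬fits = ¬fits ∘ proj₂ ∘ proj₂

  pair-≡-< : ∀ x y → size x < size y → pair (min x y) (max x y) ≡ pair x y
  pair-≡-< x y p = trans (cong (λ z → pair z (max x y)) (min-≡ˡ x y p)) (cong (pair x) (max-≡ʳ x y p))

  pair-≡-> : ∀ x y → size y < size x → pair (min x y) (max x y) ≡ pair y x
  pair-≡-> x y p = trans (cong (λ z → pair z (max x y)) (min-≡ʳ x y p)) (cong (pair y) (max-≡ˡ x y p))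

  module _ (y x : Item) where

    -- In the names that follow, the first letter is the category of the held `y` and the second
    -- that of the arriving `x`; `pairˡ` and `pairʳ` tell on which side `x` enters the pair.
    rules₁-pairˡ : M∪L y → S x → Fits x y → rules₁ (filled y) x ≡ pair x y
    rules₁-pairˡ by sx fits =
      trans (when (pairs₁? x y) (pairs-< M∪L x y x<y sx by fits)) (pair-≡-< x y x<y)
      where x<y = S<M∪L x y sx by

    rules₁-pairʳ : S y → M∪L x → Fits x y → rules₁ (filled y) x ≡ pair y x
    rules₁-pairʳ sy bx fits =
      trans (when (pairs₁? x y) (pairs-> M∪L x y y<x sy bx fits)) (pair-≡-> x y y<x)
      where y<x = S<M∪L y x sy bx

    rules₁-SS : S y → S x → rules₁ (filled y) x ≡ filled (lesser x y)
    rules₁-SS sy sx =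
      unless (pairs₁? x y) (¬B⇒¬pairs M∪L x y (S⇒¬M∪L x sx) (S⇒¬M∪L y sy))
      (select filled (S? x ×-dec x ≺? y) (x ≺? y) proj₂ (sx ,_)
      (unless (M? x ×-dec M? y ×-dec y ≺? x) (S⇒¬M x sx ∘ proj₁)
      (unless (L? y ×-dec x ≺? y) (S⇒¬L y sy ∘ proj₁) refl)))

    rules₁-MM : M y → M x → rules₁ (filled y) x ≡ filled (greater x y)
    rules₁-MM my mx =
      unless (pairs₁? x y) (¬S⇒¬pairs M∪L x y (M⇒¬S x mx) (M⇒¬S y my))
      (unless (S? x ×-dec x ≺? y) (M⇒¬S x mx ∘ proj₁)
      (select filled (M? x ×-dec M? y ×-dec y ≺? x) (y ≺? x) (proj₂ ∘ proj₂) (λ p → mx , my , p)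
      (unless (L? y ×-dec x ≺? y) (M⇒¬L y my ∘ proj₁) refl)))

    rules₁-LL : L y → L x → rules₁ (filled y) x ≡ filled (lesser x y)
    rules₁-LL ly lx =
      unless (pairs₁? x y) (¬S⇒¬pairs M∪L x y (L⇒¬S x lx) (L⇒¬S y ly))
      (unless (S? x ×-dec x ≺? y) (L⇒¬S x lx ∘ proj₁)
      (unless (M? x ×-dec M? y ×-dec y ≺? x) (L⇒¬M x lx ∘ proj₁)
      (select filled (L? y ×-dec x ≺? y) (x ≺? y) proj₂ (ly ,_) refl)))

    rules₁-SL : S y → L x → ¬ Fits x y → rules₁ (filled y) x ≡ filled y
    rules₁-SL sy lx ¬fits =
      unless (pairs₁? x y) (unfit⇒¬pairs M∪L x y ¬fits)
      (unless (S? x ×-dec x ≺? y) (L⇒¬S x lx ∘ proj₁)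
      (unless (M? x ×-dec M? y ×-dec y ≺? x) (L⇒¬M x lx ∘ proj₁)
      (unless (L? y ×-dec x ≺? y) (S⇒¬L y sy ∘ proj₁) refl)))

    rules₁-LS : L y → S x → ¬ Fits x y → rules₁ (filled y) x ≡ filled x
    rules₁-LS ly sx ¬fits =
      unless (pairs₁? x y) (unfit⇒¬pairs M∪L x y ¬fits)
      (when (S? x ×-dec x ≺? y) (sx , S<M∪L x y sx (inj₂ ly)))

    rules₁-ML : M y → L x → rules₁ (filled y) x ≡ filled y
    rules₁-ML my lx =
      unless (pairs₁? x y) (¬S⇒¬pairs M∪L x y (L⇒¬S x lx) (M⇒¬S y my))
      (unless (S? x ×-dec x ≺? y) (L⇒¬S x lx ∘ proj₁)
      (unless (M? x ×-dec M? y ×-dec y ≺? x) (L⇒¬M x lx ∘ proj₁)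
      (unless (L? y ×-dec x ≺? y) (M⇒¬L y my ∘ proj₁) refl)))

    rules₁-LM : L y → M x → rules₁ (filled y) x ≡ filled x
    rules₁-LM ly mx =
      unless (pairs₁? x y) (¬S⇒¬pairs M∪L x y (M⇒¬S x mx) (L⇒¬S y ly))
      (unless (S? x ×-dec x ≺? y) (M⇒¬S x mx ∘ proj₁)
      (unless (M? x ×-dec M? y ×-dec y ≺? x) (L⇒¬M y ly ∘ proj₁ ∘ proj₂)
      (when (L? y ×-dec x ≺? y) (ly , M<L x y mx ly))))

    rules₂-pairˡ : L y → S x → Fits x y → rules₂ (filled y) x ≡ pair x y
    rules₂-pairˡ ly sx fits =
      trans (when (pairs₂? x y) (pairs-< L x y x<y sx ly fits)) (pair-≡-< x y x<y)
      where x<y = S<M∪L x y sx (inj₂ ly)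

    rules₂-pairʳ : S y → L x → Fits x y → rules₂ (filled y) x ≡ pair y x
    rules₂-pairʳ sy lx fits =
      trans (when (pairs₂? x y) (pairs-> L x y y<x sy lx fits)) (pair-≡-> x y y<x)
      where y<x = S<M∪L y x sy (inj₂ lx)

    rules₂-SS : S y → S x → rules₂ (filled y) x ≡ filled (lesser x y)
    rules₂-SS sy sx =
      unless (pairs₂? x y) (¬B⇒¬pairs L x y (S⇒¬L x sx) (S⇒¬L y sy))
      (unless (L? x ×-dec (S? y ⊎-dec M? y)) (S⇒¬L x sx ∘ proj₁)
      (unless (L? x ×-dec x ≺? y) (S⇒¬L x sx ∘ proj₁)
      (select filled (S? x ×-dec (S? y ⊎-dec M? y) ×-dec x ≺? y) (x ≺? y)
        (proj₂ ∘ proj₂) (λ p → sx , inj₁ sy , p)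
      (unless (M? x ×-dec M? y ×-dec y ≺? x) (S⇒¬M x sx ∘ proj₁) refl))))

    rules₂-MM : M y → M x → rules₂ (filled y) x ≡ filled (greater x y)
    rules₂-MM my mx =
      unless (pairs₂? x y) (¬S⇒¬pairs L x y (M⇒¬S x mx) (M⇒¬S y my))
      (unless (L? x ×-dec (S? y ⊎-dec M? y)) (M⇒¬L x mx ∘ proj₁)
      (unless (L? x ×-dec x ≺? y) (M⇒¬L x mx ∘ proj₁)
      (unless (S? x ×-dec (S? y ⊎-dec M? y) ×-dec x ≺? y) (M⇒¬S x mx ∘ proj₁)
      (select filled (M? x ×-dec M? y ×-dec y ≺? x) (y ≺? x) (proj₂ ∘ proj₂) (λ p → mx , my , p) refl))))

    rules₂-LL : L y → L x → rules₂ (filled y) x ≡ filled (lesser x y)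
    rules₂-LL ly lx =
      unless (pairs₂? x y) (¬S⇒¬pairs L x y (L⇒¬S x lx) (L⇒¬S y ly))
      (unless (L? x ×-dec (S? y ⊎-dec M? y)) (Sum.[ L⇒¬S y ly , L⇒¬M y ly ]′ ∘ proj₂)
      (select filled (L? x ×-dec x ≺? y) (x ≺? y) proj₂ (lx ,_)
      (unless (S? x ×-dec (S? y ⊎-dec M? y) ×-dec x ≺? y) (L⇒¬S x lx ∘ proj₁)
      (unless (M? x ×-dec M? y ×-dec y ≺? x) (L⇒¬M x lx ∘ proj₁) refl))))

    rules₂-SL : S y → L x → ¬ Fits x y → rules₂ (filled y) x ≡ filled x
    rules₂-SL sy lx ¬fits =
      unless (pairs₂? x y) (unfit⇒¬pairs L x y ¬fits)
      (when (L? x ×-dec (S? y ⊎-dec M? y)) (lx , inj₁ sy))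

    rules₂-ML : M y → L x → rules₂ (filled y) x ≡ filled x
    rules₂-ML my lx =
      unless (pairs₂? x y) (¬S⇒¬pairs L x y (L⇒¬S x lx) (M⇒¬S y my))
      (when (L? x ×-dec (S? y ⊎-dec M? y)) (lx , inj₂ my))

    rules₂-LS : L y → S x → ¬ Fits x y → rules₂ (filled y) x ≡ filled y
    rules₂-LS ly sx ¬fits =
      unless (pairs₂? x y) (unfit⇒¬pairs L x y ¬fits)
      (unless (L? x ×-dec (S? y ⊎-dec M? y)) (S⇒¬L x sx ∘ proj₁)
      (unless (L? x ×-dec x ≺? y) (S⇒¬L x sx ∘ proj₁)
      (unless (S? x ×-dec (S? y ⊎-dec M? y) ×-dec x ≺? y)
        (Sum.[ L⇒¬S y ly , L⇒¬M y ly ]′ ∘ proj₁ ∘ proj₂)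
      (unless (M? x ×-dec M? y ×-dec y ≺? x) (S⇒¬M x sx ∘ proj₁) refl))))

    rules₂-LM : L y → M x → rules₂ (filled y) x ≡ filled y
    rules₂-LM ly mx =
      unless (pairs₂? x y) (¬S⇒¬pairs L x y (M⇒¬S x mx) (L⇒¬S y ly))
      (unless (L? x ×-dec (S? y ⊎-dec M? y)) (M⇒¬L x mx ∘ proj₁)
      (unless (L? x ×-dec x ≺? y) (M⇒¬L x mx ∘ proj₁)
      (unless (S? x ×-dec (S? y ⊎-dec M? y) ×-dec x ≺? y) (M⇒¬S x mx ∘ proj₁)
      (unless (M? x ×-dec M? y ×-dec y ≺? x) (L⇒¬M y ly ∘ proj₁ ∘ proj₂) refl))))

    rules₂-SM : S y → M x → rules₂ (filled y) x ≡ filled y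
    rules₂-SM sy mx =
      unless (pairs₂? x y) (¬B⇒¬pairs L x y (M⇒¬L x mx) (S⇒¬L y sy))
      (unless (L? x ×-dec (S? y ⊎-dec M? y)) (M⇒¬L x mx ∘ proj₁)
      (unless (L? x ×-dec x ≺? y) (M⇒¬L x mx ∘ proj₁)
      (unless (S? x ×-dec (S? y ⊎-dec M? y) ×-dec x ≺? y) (M⇒¬S x mx ∘ proj₁)
      (unless (M? x ×-dec M? y ×-dec y ≺? x) (S⇒¬M y sy ∘ proj₁ ∘ proj₂) refl))))

    rules₂-MS : M y → S x → rules₂ (filled y) x ≡ filled x
    rules₂-MS my sx =
      unless (pairs₂? x y) (¬B⇒¬pairs L x y (S⇒¬L x sx) (M⇒¬L y my))
      (unless (L? x ×-dec (S? y ⊎-dec M? y)) (S⇒¬L x sx ∘ proj₁)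
      (unless (L? x ×-dec x ≺? y) (S⇒¬L x sx ∘ proj₁)
      (when (S? x ×-dec (S? y ⊎-dec M? y) ×-dec x ≺? y)
        (sx , inj₂ my , S<M∪L x y sx (inj₁ my)))))

  module _ (s b x : Item) where

    fits-pair? : Dec (size b < size x × Fits x s)
    fits-pair? = b ≺? x ×-dec size x + size s ≤? 1#

    -- An item below `s` must lie in `S` and one above `b` in `M∪L`, so A₁ only exchanges a
    -- component for one of the same kind. The last case receives the failed guard because `SB-L`
    -- must know why `x` was refused.
    rules₁-pair : ∀ {p} (P : Pred Knap p) → S s → M∪L b → S x ⊎ M∪L x →
                  (S x → P (pair x b)) →
                  (M∪L x → size b < size x → P (pair s x)) →
                  (¬ (size b < size x × Fits x s) → P (pair s b)) →
                  P (rules₁ (pair s b) x)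
    rules₁-pair P ss bb sb p₁ p₂ p₃ =
      if-elim P (x ≺? s) (λ x<s → Sum.[ p₁ , (λ bx → contradiction (proj₁ x<s) (<⇒≱ (S<M∪L s x ss bx))) ]′ sb)
      (λ _ → if-elim P fits-pair?
        (λ (b<x , _) → Sum.[ (λ sx → contradiction (proj₁ b<x) (<⇒≱ (S<M∪L x b sx bb))) , (λ bx → p₂ bx b<x) ]′ sb)
        p₃)

    rules₁-pair-S : M∪L b → S x → rules₁ (pair s b) x ≡ pair (lesser x s) b
    rules₁-pair-S bb sx =
      select (λ z → pair z b) (x ≺? s) (x ≺? s) (λ p → p) (λ p → p)
      (unless fits-pair? (λ (b<x , _) → <⇒≱ (S<M∪L x b sx bb) (proj₁ b<x)) refl)

    rules₁-pair-M : S s → M x → rules₁ (pair s b) x ≡ pair s (greater x b)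
    rules₁-pair-M ss mx =
      unless (x ≺? s) (λ x<s → <⇒≱ (S<M∪L s x ss (inj₁ mx)) (proj₁ x<s))
      (select (pair s) fits-pair? (b ≺? x) proj₁ (_, Fits-sym s x (S-fits-M s x ss mx)) refl)

    rules₁-pair-unfit : S s → M∪L x → ¬ Fits x s → rules₁ (pair s b) x ≡ pair s b
    rules₁-pair-unfit ss bx ¬fits =
      unless (x ≺? s) (λ x<s → <⇒≱ (S<M∪L s x ss bx) (proj₁ x<s))
      (unless fits-pair? (¬fits ∘ proj₂) refl)

  -- The joint run of the two strategies

  -- The possible pairs of knapsacks of A₁ and A₂ once the items of J, none of
  -- them in G, have arrived.  The second alternative of SB-L is needed since an
  -- item of L that replaces a larger one in A₂ may newly fit s.
  data Joint (J : Instance) : Knap → Knap → Set (c ⊔ ℓ₁ ⊔ ℓ₂) where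
    none : All (λ _ → ⊥) J → Joint J empty empty
    S-S  : ∀ {s} → S s → All (λ j → S j × size s ≤ size j) J →
           Joint J (filled s) (filled s)
    M-M  : ∀ {m} → M m → All M J → Joint J (filled m) (filled m)
    L-L  : ∀ {l} → L l → All (λ j → L j × size l ≤ size j) J →
           Joint J (filled l) (filled l)
    M-L  : ∀ {m l} → M m → L l → All M∪L J → Joint J (filled m) (filled l)
    S-L  : ∀ {s l} → S s → L l → ¬ Fits s l →
           All (λ j → (S j × size s ≤ size j) ⊎ (L j × size l ≤ size j)) J →
           Joint J (filled s) (filled l)
    SM-S : ∀ {s m} → S s → M m → Joint J (pair s m) (filled s)
    SB-L : ∀ {s b l} → S s → M∪L b → L l → ¬ Fits s l ⊎ size l ≤ size b →
           Joint J (pair s b) (filled l)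
    S-SL : ∀ {s s′ l} → S s → S s′ → L l → Joint J (filled s) (pair s′ l)
    SB-SL : ∀ {s b s′ l} → S s → M∪L b → S s′ → L l → Joint J (pair s b) (pair s′ l)

  via : ∀ {J K₁ K₂ K₁′ K₂′} → K₁ ≡ K₁′ → K₂ ≡ K₂′ → Joint J K₁′ K₂′ → Joint J K₁ K₂
  via eq₁ eq₂ = subst₂ (Joint _) (sym eq₁) (sym eq₂)

  fits-or-not : ∀ x y → Fits x y ⊎ ¬ Fits x y
  fits-or-not x y = toSum (size x + size y ≤? 1#)

  lower-min : ∀ {p} (P : Pred Item p) {J} x y → P x → All (λ j → P j × size y ≤ size j) J →
              All (λ j → P j × size (lesser x y) ≤ size j) (x ∷ J)
  lower-min P x y px ps =
    (px , lesser≤ˡ x y) ∷ All.map (λ (pj , y≤j) → pj , ≤-trans (lesser≤ʳ x y) y≤j) ps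

  -- Once A₂ holds a pair, only the categories of the pair of A₁ matter, and these survive every
  -- exchange.
  keep-SB : ∀ {J} s b {s′ l} x → S x ⊎ M∪L x → S s → M∪L b → S s′ → L l →
            Joint (x ∷ J) (rules₁ (pair s b) x) (pair s′ l)
  keep-SB s b x cx ss bb ss′ ll =
    rules₁-pair s b x (λ K → Joint _ K _) ss bb cx
      (λ sx → SB-SL sx bb ss′ ll) (λ bx _ → SB-SL ss bx ss′ ll) (λ _ → SB-SL ss bb ss′ ll)

  -- The minimality of `s` and `l` among the arrived items of their categories lets one failed fit
  -- test exclude all pairs from `S` and `L`.
  advance : ∀ {J K₁ K₂} x → Joint J K₁ K₂ → S x ⊎ M∪L x →
            Joint (x ∷ J) (rules₁ K₁ x) (rules₂ K₂ x)

  advance x (none ps) (inj₁ sx) = S-S sx ((sx , ≤-refl) ∷ All.map ⊥-elim ps)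
  advance x (none ps) (inj₂ (inj₁ mx)) = M-M mx (mx ∷ All.map ⊥-elim ps)
  advance x (none ps) (inj₂ (inj₂ lx)) = L-L lx ((lx , ≤-refl) ∷ All.map ⊥-elim ps)

  advance x (S-S {s} ss ps) (inj₁ sx) =
    via (rules₁-SS s x ss sx) (rules₂-SS s x ss sx)
      (S-S (lesser-elim S x s sx ss) (lower-min S x s sx ps))
  advance x (S-S {s} ss ps) (inj₂ (inj₁ mx)) =
    via (rules₁-pairʳ s x ss (inj₁ mx) (Fits-sym s x (S-fits-M s x ss mx))) (rules₂-SM s x ss mx)
      (SM-S ss mx)
  advance x (S-S {s} ss ps) (inj₂ (inj₂ lx)) with fits-or-not x s
  ... | inj₁ fits = via (rules₁-pairʳ s x ss (inj₂ lx) fits) (rules₂-pairʳ s x ss lx fits)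
                     (SB-SL ss (inj₂ lx) ss lx)
  ... | inj₂ ¬fits = via (rules₁-SL s x ss lx ¬fits) (rules₂-SL s x ss lx ¬fits)
                     (S-L ss lx (¬fits ∘ Fits-sym s x) (inj₂ (lx , ≤-refl) ∷ All.map inj₁ ps))

  advance x (M-M {m} mm ps) (inj₁ sx) =
    via (rules₁-pairˡ m x (inj₁ mm) sx (S-fits-M x m sx mm)) (rules₂-MS m x mm sx) (SM-S sx mm)
  advance x (M-M {m} mm ps) (inj₂ (inj₁ mx)) =
    via (rules₁-MM m x mm mx) (rules₂-MM m x mm mx) (M-M (greater-elim M x m mx mm) (mx ∷ ps))
  advance x (M-M {m} mm ps) (inj₂ (inj₂ lx)) =
    via (rules₁-ML m x mm lx) (rules₂-ML m x mm lx) (M-L mm lx (inj₂ lx ∷ All.map inj₁ ps))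

  advance x (L-L {l} ll ps) (inj₁ sx) with fits-or-not x l
  ... | inj₁ fits = via (rules₁-pairˡ l x (inj₂ ll) sx fits) (rules₂-pairˡ l x ll sx fits)
                     (SB-SL sx (inj₂ ll) sx ll)
  ... | inj₂ ¬fits = via (rules₁-LS l x ll sx ¬fits) (rules₂-LS l x ll sx ¬fits)
                     (S-L sx ll ¬fits (inj₁ (sx , ≤-refl) ∷ All.map inj₂ ps))
  -- Here the strategies diverge: A₁ takes the item of `M`, which fits every item of `S`, while A₂
  -- keeps the larger gain of `l`.
  advance x (L-L {l} ll ps) (inj₂ (inj₁ mx)) =
    via (rules₁-LM l x ll mx) (rules₂-LM l x ll mx) (M-L mx ll (inj₁ mx ∷ All.map (inj₂ ∘ proj₁) ps))
  advance x (L-L {l} ll ps) (inj₂ (inj₂ lx)) =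
    via (rules₁-LL l x ll lx) (rules₂-LL l x ll lx)
      (L-L (lesser-elim L x l lx ll) (lower-min L x l lx ps))

  advance x (M-L {m} {l} mm ll ps) (inj₁ sx) with fits-or-not x l
  ... | inj₁ fits = via (rules₁-pairˡ m x (inj₁ mm) sx (S-fits-M x m sx mm)) (rules₂-pairˡ l x ll sx fits)
                     (SB-SL sx (inj₁ mm) sx ll)
  ... | inj₂ ¬fits = via (rules₁-pairˡ m x (inj₁ mm) sx (S-fits-M x m sx mm)) (rules₂-LS l x ll sx ¬fits)
                     (SB-L sx (inj₁ mm) ll (inj₁ ¬fits))
  advance x (M-L {m} {l} mm ll ps) (inj₂ (inj₁ mx)) =
    via (rules₁-MM m x mm mx) (rules₂-LM l x ll mx) (M-L (greater-elim M x m mx mm) ll (inj₁ mx ∷ ps))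
  advance x (M-L {m} {l} mm ll ps) (inj₂ (inj₂ lx)) =
    via (rules₁-ML m x mm lx) (rules₂-LL l x ll lx) (M-L mm (lesser-elim L x l lx ll) (inj₂ lx ∷ ps))

  advance x (S-L {s} {l} ss ll ¬fits ps) (inj₁ sx) with fits-or-not x l
  ... | inj₁ fits = via (rules₁-SS s x ss sx) (rules₂-pairˡ l x ll sx fits)
                     (S-SL (lesser-elim S x s sx ss) sx ll)
  ... | inj₂ ¬fits′ = via (rules₁-SS s x ss sx) (rules₂-LS l x ll sx ¬fits′)
      (S-L (lesser-elim S x s sx ss) ll (lesser-elim (λ z → ¬ Fits z l) x s ¬fits′ ¬fits)
        (inj₁ (sx , lesser≤ˡ x s) ∷ All.map (Sum.map₁ (λ (sj , p) → sj , ≤-trans (lesser≤ʳ x s) p)) ps))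
  advance x (S-L {s} {l} ss ll ¬fits ps) (inj₂ (inj₁ mx)) =
    via (rules₁-pairʳ s x ss (inj₁ mx) (Fits-sym s x (S-fits-M s x ss mx))) (rules₂-LM l x ll mx)
      (SB-L ss (inj₁ mx) ll (inj₁ ¬fits))
  advance x (S-L {s} {l} ss ll ¬fits ps) (inj₂ (inj₂ lx)) with fits-or-not x s
  -- A₁ pairs `x` while A₂ keeps an item no larger than `x`, which is the second alternative of
  -- `SB-L`.
  ... | inj₁ fits = via (rules₁-pairʳ s x ss (inj₂ lx) fits) (rules₂-LL l x ll lx)
      (SB-L ss (inj₂ lx) (lesser-elim L x l lx ll) (inj₂ (lesser≤ˡ x l)))
  ... | inj₂ ¬fits′ = via (rules₁-SL s x ss lx ¬fits′) (rules₂-LL l x ll lx)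
      (S-L ss (lesser-elim L x l lx ll)
        (lesser-elim (λ z → ¬ Fits s z) x l (¬fits′ ∘ Fits-sym s x) ¬fits)
        (inj₂ (lx , lesser≤ˡ x l) ∷ All.map (Sum.map₂ (λ (lj , p) → lj , ≤-trans (lesser≤ʳ x l) p)) ps))

  advance x (SM-S {s} {m} ss mm) (inj₁ sx) =
    via (rules₁-pair-S s m x (inj₁ mm) sx) (rules₂-SS s x ss sx) (SM-S (lesser-elim S x s sx ss) mm)
  advance x (SM-S {s} {m} ss mm) (inj₂ (inj₁ mx)) =
    via (rules₁-pair-M s m x ss mx) (rules₂-SM s x ss mx) (SM-S ss (greater-elim M x m mx mm))
  advance x (SM-S {s} {m} ss mm) (inj₂ (inj₂ lx)) with fits-or-not x s
  ... | inj₁ fits = via refl (rules₂-pairʳ s x ss lx fits)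
                     (keep-SB s m x (inj₂ (inj₂ lx)) ss (inj₁ mm) ss lx)
  ... | inj₂ ¬fits = via (rules₁-pair-unfit s m x ss (inj₂ lx) ¬fits) (rules₂-SL s x ss lx ¬fits)
                     (SB-L ss (inj₁ mm) lx (inj₁ (¬fits ∘ Fits-sym s x)))

  advance x (SB-L {s} {b} {l} ss bb ll c) (inj₁ sx) with fits-or-not x l
  ... | inj₁ fits = via refl (rules₂-pairˡ l x ll sx fits) (keep-SB s b x (inj₁ sx) ss bb sx ll)
  ... | inj₂ ¬fits = via refl (rules₂-LS l x ll sx ¬fits)
      (rules₁-pair s b x (λ K → Joint _ K _) ss bb (inj₁ sx)
        (λ _ → SB-L sx bb ll (inj₁ ¬fits))
        (λ bx _ → contradiction bx (S⇒¬M∪L x sx))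
        (λ _ → SB-L ss bb ll c))
  advance x (SB-L {s} {b} {l} ss bb ll c) (inj₂ (inj₁ mx)) =
    via refl (rules₂-LM l x ll mx)
      (rules₁-pair s b x (λ K → Joint _ K _) ss bb (inj₂ (inj₁ mx))
        (λ sx → contradiction mx (S⇒¬M x sx))
        (λ bx b<x → SB-L ss bx ll (Sum.map₂ (λ l≤b → ≤-trans l≤b (proj₁ b<x)) c))
        (λ _ → SB-L ss bb ll c))
  advance {J} x (SB-L {s} {b} {l} ss bb ll c) (inj₂ (inj₂ lx)) =
    via refl (rules₂-LL l x ll lx)
      (rules₁-pair s b x (λ K → Joint (x ∷ J) K (filled l′)) ss bb (inj₂ (inj₂ lx))
        (λ sx → contradiction lx (S⇒¬L x sx))
        (λ bx _ → SB-L ss bx ll′ (inj₂ (lesser≤ˡ x l)))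
        (λ stay → SB-L ss bb ll′ (Sum.[ unfit stay , inj₂ ∘ ≤-trans (lesser≤ʳ x l) ]′ c)))
    where
    l′ = lesser x l
    ll′ = lesser-elim L x l lx ll
    -- If `x` fits `s`, A₁ refused it because it is at most `b`, which bounds `l′`; otherwise
    -- neither candidate for `l′` fits `s`.
    unfit : ¬ (size b < size x × Fits x s) → ¬ Fits s l → ¬ Fits s l′ ⊎ size l′ ≤ size b
    unfit stay ¬fits with fits-or-not x s
    ... | inj₁ fits  = inj₂ (≤-trans (lesser≤ˡ x l) (≮⇒≥ (λ b<x → stay (b<x , fits))))
    ... | inj₂ ¬fits′ = inj₁ (lesser-elim (λ z → ¬ Fits s z) x l (¬fits′ ∘ Fits-sym s x) ¬fits)

  advance x (S-SL {s} ss ss′ ll) (inj₁ sx) =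
    via (rules₁-SS s x ss sx) refl (S-SL (lesser-elim S x s sx ss) ss′ ll)
  advance x (S-SL {s} ss ss′ ll) (inj₂ (inj₁ mx)) =
    via (rules₁-pairʳ s x ss (inj₁ mx) (Fits-sym s x (S-fits-M s x ss mx))) refl
      (SB-SL ss (inj₁ mx) ss′ ll)
  advance x (S-SL {s} ss ss′ ll) (inj₂ (inj₂ lx)) with fits-or-not x s
  ... | inj₁ fits = via (rules₁-pairʳ s x ss (inj₂ lx) fits) refl (SB-SL ss (inj₂ lx) ss′ ll)
  ... | inj₂ ¬fits = via (rules₁-SL s x ss lx ¬fits) refl (S-SL ss ss′ ll)

  advance x (SB-SL {s} {b} ss bb ss′ ll) cx = keep-SB s b x cx ss bb ss′ ll

  -- Membership in `G` does not depend on the knapsack, so both strategies stop at the same item.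
  data JointState (J : Instance) : State → State → Set (c ⊔ ℓ₁ ⊔ ℓ₂) where
    running : ∀ {K₁ K₂} → Joint J K₁ K₂ → JointState J (running K₁) (running K₂)
    stopped : ∀ {x} → G x → JointState J (stopped x) (stopped x)

  joint-step : ∀ {J σ₁ σ₂} x → JointState J σ₁ σ₂ →
               JointState (x ∷ J) (step rules₁ σ₁ x) (step rules₂ σ₂ x)
  joint-step x (stopped g) = stopped g
  joint-step {J} x (running {K₁} {K₂} j) = if-elim₂ (JointState (x ∷ J)) (G? x)
    stopped (λ ¬g → running (advance x j (classify x ¬g)))

  -- Arrivals are pushed onto the front of `J`, so the history comes out reversed; only membership
  -- in it matters later.
  joint-run : ∀ {J σ₁ σ₂} I → JointState J σ₁ σ₂ →
              JointState (I ʳ++ J) (foldl (step rules₁) σ₁ I) (foldl (step rules₂) σ₂ I)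
  joint-run []      j = j
  joint-run (x ∷ I) j = joint-run I (joint-step x j)

  -- The competitive bound in each joint state

  4/3-bound : Carrier → Carrier → Carrier → Set ℓ₂
  4/3-bound o g₁ g₂ = o ≤ 4 / 3 * (1 / 2 * g₁ + (1 / 2 * g₂ + 0#))

  joint-bound : ∀ {J K₁ K₂} T → Joint J K₁ K₂ → All (_∈ J) T → weight T ≤ 1# →
                4/3-bound (gain T) (gain ⟦ K₁ ⟧) (gain ⟦ K₂ ⟧)
  joint-bound {J} {K₁} {K₂} T j T⊆J T≤1 = cases j
    where
    T⊆ : ∀ {p} {P : Pred Item p} → All P J → All P T
    T⊆ ps = All.map (All.lookup ps) T⊆J

    T≤24/24 : gain T ≤ 24 /24
    T≤24/24 = ≤-respʳ-≈ 1≈24/24 T≤1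

    -- Gains adding up to 27/24 have mean 9/16, and 4/3 of that is 3/4.
    3/4-bound : ∀ {p n y z} {P : Pred Item p} →
                (∀ x → P x → S x ⊎ M∪L x) →
                (∀ x y → P x → P y → Fits x y → size x + size y ≤ 18 /24) →
                All P J → n /24 ≤ y + z → {_ : True (27 ℕ.≤? n)} → 4/3-bound (gain T) y z
    3/4-bound cat two ps n≤y+z {27≤n} = ≤4/3*mean
      (solution-bound {m = 18} cat (λ x → below-3/4 x ∘ cat x) two T (T⊆ ps) T≤1)
      (≤-trans (/24-mono-≤ (toWitness 27≤n)) n≤y+z)

    S+S-bound : ∀ x y → S x → S y → size x + size y ≤ 18 /24
    S+S-bound x y sx sy = +-upper (S-upper x sx) (S-upper y sy)

    unfit-bound : ∀ {b} x y → M∪L x → M∪L y → Fits x y → size x + size y ≤ b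
    unfit-bound x y bx by fits = contradiction fits (M∪L-unfit x y bx by)

    cases : Joint J K₁ K₂ → 4/3-bound (gain T) (gain ⟦ K₁ ⟧) (gain ⟦ K₂ ⟧)
    cases (none ps) = ≤4/3*mean
      (solution-bound {m = 0} (λ _ ()) (λ _ ()) (λ _ _ ()) T (T⊆ ps) T≤1)
      (+-lower {i = 0} (≤-reflexive (≈-sym 0≈0/24)) (≤-reflexive (≈-sym 0≈0/24)))
    cases (S-S {s} ss ps) = 3/4-bound {n = 32} (λ _ → inj₁ ∘ proj₁)
      (λ x y px py _ → S+S-bound x y (proj₁ px) (proj₁ py)) ps
      (+-lower (S-gain s ss) (S-gain s ss))
    -- A mean gain of 1/2 covers solutions up to 2/3, which is more than 15/24.
    cases (M-M {m} mm ps) = ≤4/3*mean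
      (solution-bound {m = 15} (λ _ → inj₂ ∘ inj₁) M-upper
        (λ x y mx my → unfit-bound x y (inj₁ mx) (inj₁ my)) T (T⊆ ps) T≤1)
      (+-lower {i = 24} (M-gain m mm) (M-gain m mm))
    cases (L-L {l} ll ps) = 3/4-bound {n = 30} (λ _ → inj₂ ∘ inj₂ ∘ proj₁)
      (λ x y px py → unfit-bound x y (inj₂ (proj₁ px)) (inj₂ (proj₁ py))) ps
      (+-lower (L-gain l ll) (L-gain l ll))
    -- No slack: 12 + 15 = 27. In this argument the border 5/8 of `M` and `L` cannot be lowered
    -- because of this sum, nor raised because of `S-fits-M`.
    cases (M-L {m} {l} mm ll ps) = 3/4-bound {n = 27} (λ _ → inj₂) unfit-bound ps
      (+-lower (M-gain m mm) (L-gain l ll))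
    cases (S-L {s} {l} ss ll ¬fits ps) = 3/4-bound {n = 31}
      (λ _ → Sum.map proj₁ (inj₂ ∘ proj₁)) two ps (+-lower (S-gain s ss) (L-gain l ll))
      where
      -- A mixed pair is at least as heavy as `s` and `l`, which do not fit together.
      two : ∀ x y → (S x × size s ≤ size x) ⊎ (L x × size l ≤ size x) →
            (S y × size s ≤ size y) ⊎ (L y × size l ≤ size y) →
            Fits x y → size x + size y ≤ 18 /24
      two x y (inj₁ (sx , _))   (inj₁ (sy , _))   fits = S+S-bound x y sx sy
      two x y (inj₁ (_ , s≤x))  (inj₂ (_ , l≤y))  fits =
        contradiction (≤-trans (+-mono-≤ s≤x l≤y) fits) ¬fits
      two x y (inj₂ (_ , l≤x))  (inj₁ (_ , s≤y))  fits =
        contradiction (≤-trans (+-mono-≤ s≤y l≤x) (Fits-sym x y fits)) ¬fits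
      two x y (inj₂ (lx , _))   (inj₂ (ly , _))   fits = unfit-bound x y (inj₂ lx) (inj₂ ly) fits
    -- No slack here either: 1/3 + 1/2 for the pair and 2/3 for two copies of `s` make 3/2.
    cases (SM-S {s} {m} ss mm) = ≤4/3*mean T≤24/24
      (+-lower {i = 36} (pair-gain {i = 20} s m (S-lower s ss) (M-lower m mm)) (S-gain s ss))
    -- The sum is regrouped so that `s`, held by A₁, meets `l`, held by A₂.
    cases (SB-L {s} {b} {l} ss bb ll (inj₁ ¬fits)) = ≤4/3*mean T≤24/24 (begin
      36 /24                           ≤⟨ +-lower s+l≥1 (proj₁ (M∪L-lower b bb)) ⟩
      (size s + size l) + size b       ≈⟨ xy∙z≈xz∙y _ _ _ ⟩
      (size s + size b) + size l       ≤⟨ +-mono-≤ (≤-reflexive (≈-sym (gain-pair s b))) (size≤gain-fill l) ⟩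
      gain (s ∷ b ∷ []) + gain (fill l) ∎)
      where
      s+l≥1 : 24 /24 ≤ size s + size l
      s+l≥1 = ≤-respˡ-≈ 1≈24/24 (proj₁ (≰⇒> ¬fits))
    cases (SB-L {s} {b} {l} ss bb ll (inj₂ l≤b)) = ≤4/3*mean T≤24/24
      (+-lower {i = 36} (pair-gain {i = 23} s b (S-lower s ss) (≤-trans (L-lower l ll) l≤b)) (L-gain l ll))
    cases (S-SL {s} {s′} {l} ss ss′ ll) = ≤4/3*mean T≤24/24
      (+-lower {i = 36} (S-gain s ss) (pair-gain {i = 23} s′ l (S-lower s′ ss′) (L-lower l ll)))
    cases (SB-SL {s} {b} {s′} {l} ss bb ss′ ll) = ≤4/3*mean T≤24/24
      (+-lower {i = 36} (pair-gain {i = 20} s b (S-lower s ss) (proj₁ (M∪L-lower b bb)))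
        (pair-gain {i = 23} s′ l (S-lower s′ ss′) (L-lower l ll)))

  4/3-competitive : IsCompetitive RandChoice (4 / 3)
  4/3-competitive = 1≤4/3 , λ I T ((T⊆I , T≤1) , _) →
    bound I T (joint-run I (running (none []))) T⊆I T≤1
    where
    1≤4/3 : 1# ≤ 4 / 3
    1≤4/3 = begin
      1#     ≈⟨ 1≈24/24 ⟩
      24 /24 ≤⟨ /24-mono-≤ (ℕ.m≤m+n 24 8) ⟩
      32 /24 ≈⟨ /≈/24 4 3 32 ⟨
      4 / 3  ∎
    bound : ∀ I {σ₁ σ₂} T → JointState (reverse I) σ₁ σ₂ → All (_∈ I) T → weight T ≤ 1# →
            4/3-bound (gain T) (gain (contents σ₁)) (gain (contents σ₂))
    bound I T (running j) T⊆I T≤1 = joint-bound T j (All.map reverse⁺ T⊆I) T≤1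
    bound I T (stopped {x} g) T⊆I T≤1 =
      ≤4/3*mean (≤-respʳ-≈ 1≈24/24 T≤1) (+-lower {i = 36} (G-gain x g) (G-gain x g))

  -- An instance that attains the ratio

  3/4-item 1-item : Item
  3/4-item = record
    { size   = 18 /24
    ; 0<size = ≤-respˡ-≈ (≈-sym 0≈0/24) (/24-mono-≤ ℕ.z≤n)
             , λ eq → proj₂ (/24-mono-< {0} {18} (ℕ.s≤s ℕ.z≤n)) (≈-trans (≈-sym 0≈0/24) eq)
    ; size≤1 = ≤1⇐ (/24-mono-≤ (ℕ.m≤m+n 18 6))
    }
  1-item = record { size = 1# ; 0<size = 0≤1 , 0≉1 ; size≤1 = ≤-refl }

  3/4-item∈G : G 3/4-item
  3/4-item∈G = inj₂ (inj₂ (≤-reflexive (/≈/24 3 4 18) , size≤1 3/4-item))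

  -- The floor does not compute in an abstract field. The number `k` of copies is bounded through
  -- feasibility instead: two copies would weigh 36/24.
  gain-3/4-item : gain (fill 3/4-item) ≤ 18 /24
  gain-3/4-item with ⌊ size 3/4-item ⁻¹ ⌋ | weight-replicate ⌊ size 3/4-item ⁻¹ ⌋ 3/4-item | weight-fill≤1 3/4-item
  ... | k | eq | fill≤1 = ≤-respˡ-≈ (≈-sym (≈-trans eq (≈-sym (*-/24 k)))) (/24-mono-≤ (k*18≤18 k k*18≤24))
    where
    k*18≤24 : (k ℕ.* 18) ℕ.≤ 24
    k*18≤24 = ℕ.≮⇒≥ λ 24<k*18 → <⇒≱ (/24-mono-< 24<k*18)
      (≤-respˡ-≈ (≈-trans eq (≈-sym (*-/24 k))) (≤-respʳ-≈ 1≈24/24 fill≤1))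
    k*18≤18 : ∀ k → (k ℕ.* 18) ℕ.≤ 24 → (k ℕ.* 18) ℕ.≤ 18
    k*18≤18 zero          _ = ℕ.z≤n
    k*18≤18 (suc zero)    _ = ℕ.≤-refl
    k*18≤18 (suc (suc k)) p = contradiction (ℕ.≤-trans (ℕ.m≤m+n 36 (k ℕ.* 18)) p) (ℕ.<⇒≱ (ℕ.m≤m+n 25 11))

  run-3/4-item : ∀ rules → run rules (3/4-item ∷ 1-item ∷ []) ≡ stopped 3/4-item
  run-3/4-item rules = cong (λ σ → step rules σ 1-item) (when (G? 3/4-item) 3/4-item∈G)

  1-item-optimal : IsOptimal (3/4-item ∷ 1-item ∷ []) (1-item ∷ [])
  1-item-optimal = (there (here refl) ∷ [] , ≤-reflexive (+-identityʳ 1#))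
             , λ T (_ , T≤1) → ≤-respʳ-≈ (≈-sym (+-identityʳ 1#)) T≤1

  -- The optimum gains 1 and both strategies stop at 3/4, so `r` times 3/4 is at least 1; the claim
  -- follows on dividing by 3/4.
  4/3-lower-bound : ∀ r → IsCompetitive RandChoice r → 4 / 3 ≤ r
  4/3-lower-bound r (1≤r , competitive) = *-cancelʳ-≤ (0≤size 3/4-item) (size≉0 3/4-item) (begin
    4 / 3 * 18 /24                                  ≈⟨ *-congˡ (*-/24 3) ⟩
    4 / 3 * (fromℕ 3 * 6 /24)                       ≈⟨ *-assoc _ _ _ ⟨
    4 / 3 * fromℕ 3 * 6 /24                         ≈⟨ *-congʳ (/-cleared 4 3) ⟩
    fromℕ 4 * 6 /24                                 ≈⟨ *-/24 4 ⟨
    24 /24                                          ≈⟨ 1≈24/24 ⟨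
    1#                                              ≈⟨ +-identityʳ 1# ⟨
    gain (1-item ∷ [])                                  ≤⟨ competitive I (1-item ∷ []) 1-item-optimal ⟩
    r * expectedGain RandChoice I                   ≤⟨ *-monoʳ-≤ (≤-trans 0≤1 1≤r) mean≤ ⟩
    r * 18 /24                                      ∎)
    where
    I = 3/4-item ∷ 1-item ∷ []
    gain≤ : ∀ rules → gain (contents (run rules I)) ≤ 18 /24
    gain≤ rules = subst (λ σ → gain (contents σ) ≤ 18 /24) (sym (run-3/4-item rules)) gain-3/4-item
    mean≤ : expectedGain RandChoice I ≤ 18 /24
    mean≤ = begin
      1 / 2 * gain (contents (run rules₁ I)) + (1 / 2 * gain (contents (run rules₂ I)) + 0#)
        ≤⟨ +-mono-≤ (*-monoʳ-≤ 0≤1/2 (gain≤ rules₁)) (+-monoˡ-≤ 0# (*-monoʳ-≤ 0≤1/2 (gain≤ rules₂))) ⟩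
      1 / 2 * 18 /24 + (1 / 2 * 18 /24 + 0#)
        ≈⟨ +-congˡ (+-congˡ (zeroˡ (18 /24))) ⟨
      1 / 2 * 18 /24 + (1 / 2 * 18 /24 + 0# * 18 /24)
        ≈⟨ +-congˡ (distribʳ _ _ _) ⟨
      1 / 2 * 18 /24 + (1 / 2 + 0#) * 18 /24
        ≈⟨ distribʳ _ _ _ ⟨
      (1 / 2 + (1 / 2 + 0#)) * 18 /24
        ≈⟨ *-congʳ 1/2+1/2≈1 ⟩
      1# * 18 /24
        ≈⟨ *-identityˡ _ ⟩
      18 /24 ∎

theorem1 :
    ∀ {c ℓ₁ ℓ₂} (R : ArchimedeanOrderedField c ℓ₁ ℓ₂) →
    let open ArchimedeanOrderedField R
        open Knapsack R
    in ∃[ ρ ] (IsCompetitiveRatio RandChoice ρ × ρ ≤ 4 / 3)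
-- The infimum is attained, so a lower bound `l` of all competitive constants is compared with 4/3
-- itself.
theorem1 R = 4 / 3 , (4/3-lower-bound , λ l l≤ → l≤ (4 / 3) 4/3-competitive) , ≤-refl
  where
  open ArchimedeanOrderedField R
  open Analysis R
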